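{- Let $K \subsetneq L$ be a field extension, and let $A$ and $B$ be two $n$-dimensional $K$-subspaces of $L$, with $n > 0$. Then the pair $(A,B)$ is unmatchable if and only if there exists a nonzero $K$-subspace $R$ of $B$ such that $A$ and $B$ can be written as (internal) direct sums of $K$-subspaces $$A = S \oplus Y, \qquad B = R \oplus Z,$$ where $\dim_K Y < \dim_K R$ and $$S = \bigoplus_{i=1}^m a_i K(R)$$ for some $a_1,\ldots,a_m \in S$. Here, $m = \dim_{K(R)} S = (\dim_K S)/[K(R):K]$.
   Context: Let $K\subsetneq L$ be a field extension and let $A,B$ be $n$-dimensional $K$-subspaces of $L$ with $n>0$. For a subset $X$ of $L$, $\langle X\rangle$ denotes the $K$-subspace of $L$ spanned by $X$. An ordered basis $\{a_1,\ldots,a_n\}$ of $A$ is matched to an ordered basis $\{b_1,\ldots,b_n\}$ of $B$ if, for each $i\in\{1,\ldots,n\}$, $a_i^{ -1}A\cap B\subseteq \langle b_1,\ldots,b_{i-1},b_{i+1},\ldots,b_n\rangle$. The subspace $A$ is matched to $B$ (equivalently, the pair $(A,B)$ is matchable) if every ordered basis of $A$ can be matched to some ordered basis of $B$; otherwise $(A,B)$ is unmatchable. For a subset $R\subseteq L$, $K(R)$ denotes the smallest subfield of $L$ containing $K\cup R$, and for an intermediate field $F$ of $K\subseteq L$, $[F:K]$ denotes the $K$-dimension of $F$. -}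

module Defs where

open import Algebra.Apartness.Bundles using (HeytingField)
open import Data.Fin.Base using (Fin)
open import Data.Nat.Base using (ℕ; _<_)
open import Data.Product.Base using (∃; ∃-syntax; _×_)
open import Data.Vec.Functional using (Vector; []; _∷_)
open import Function.Bundles using (_⇔_)
open import Level using (Level; suc)
open import Relation.Binary.PropositionalEquality.Core using (_≢_)
open import Relation.Nullary.Negation.Core using (¬_)
open import Relation.Unary using (Pred; _∈_; _∉_; _⊆_; _∩_)

-- Subsets of L are predicates; subfields and subspaces are required to
-- respect the setoid equality _≈_ of L.  One universe level is used
-- throughout so that spans, generated subfields, etc. are subsets of L
-- of the same kind.

module Extension {ℓ : Level} (L : HeytingField ℓ ℓ ℓ) where

  open HeytingField L using (Carrier; _≈_; _+_; _*_; -_; 0#; 1#; +-isCommutativeMonoid)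

  open import Algebra.Bundles using (CommutativeMonoid)

  +-commutativeMonoid : CommutativeMonoid ℓ ℓ
  +-commutativeMonoid = record { isCommutativeMonoid = +-isCommutativeMonoid }

  open import Algebra.Properties.CommutativeMonoid.Sum +-commutativeMonoid public using (sum)

  Subset : Set (suc ℓ)
  Subset = Pred Carrier ℓ

  record IsSubfield (F : Subset) : Set ℓ where
    field
      resp      : ∀ {x y} → x ≈ y → x ∈ F → y ∈ F
      0-closed  : 0# ∈ F
      1-closed  : 1# ∈ F
      +-closed  : ∀ {x y} → x ∈ F → y ∈ F → x + y ∈ F
      *-closed  : ∀ {x y} → x ∈ F → y ∈ F → x * y ∈ F
      -‿closed  : ∀ {x} → x ∈ F → - x ∈ F
      ⁻¹-closed : ∀ {x y} → x ∈ F → x * y ≈ 1# → y ∈ F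

  _⊊L : Subset → Set ℓ
  K ⊊L = ∃[ x ] x ∉ K

  -- K ⟮ R ⟯ is K(R); see ⟮⟯-isSubfield and ⟮⟯-least.

  data _⟮_⟯ (K R : Subset) : Subset where
    base : ∀ {x} → x ∈ K → x ∈ K ⟮ R ⟯
    gen  : ∀ {x} → x ∈ R → x ∈ K ⟮ R ⟯
    cong : ∀ {x y} → x ≈ y → x ∈ K ⟮ R ⟯ → y ∈ K ⟮ R ⟯
    add  : ∀ {x y} → x ∈ K ⟮ R ⟯ → y ∈ K ⟮ R ⟯ → x + y ∈ K ⟮ R ⟯
    mul  : ∀ {x y} → x ∈ K ⟮ R ⟯ → y ∈ K ⟮ R ⟯ → x * y ∈ K ⟮ R ⟯
    neg  : ∀ {x} → x ∈ K ⟮ R ⟯ → - x ∈ K ⟮ R ⟯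
    inv  : ∀ {x y} → x ∈ K ⟮ R ⟯ → x * y ≈ 1# → y ∈ K ⟮ R ⟯

  ⟮⟯-isSubfield : ∀ {K} R → IsSubfield K → IsSubfield (K ⟮ R ⟯)
  ⟮⟯-isSubfield R K-sub = record
    { resp      = cong
    ; 0-closed  = base (IsSubfield.0-closed K-sub)
    ; 1-closed  = base (IsSubfield.1-closed K-sub)
    ; +-closed  = add
    ; *-closed  = mul
    ; -‿closed  = neg
    ; ⁻¹-closed = inv
    }

  ⟮⟯-least : ∀ {K R F} → IsSubfield F → K ⊆ F → R ⊆ F → K ⟮ R ⟯ ⊆ F
  ⟮⟯-least {K} {R} {F} F-sub K⊆F R⊆F = go
    where
    module F = IsSubfield F-sub
    go : K ⟮ R ⟯ ⊆ F
    go (base x∈K)   = K⊆F x∈K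
    go (gen x∈R)    = R⊆F x∈R
    go (cong x≈y p) = F.resp x≈y (go p)
    go (add p q)    = F.+-closed (go p) (go q)
    go (mul p q)    = F.*-closed (go p) (go q)
    go (neg p)      = F.-‿closed (go p)
    go (inv p e)    = F.⁻¹-closed (go p) e

  record IsSubspace (F V : Subset) : Set ℓ where
    field
      resp     : ∀ {x y} → x ≈ y → x ∈ V → y ∈ V
      0-closed : 0# ∈ V
      +-closed : ∀ {x y} → x ∈ V → y ∈ V → x + y ∈ V
      *-closed : ∀ {c x} → c ∈ F → x ∈ V → c * x ∈ V

  Span : (F X : Subset) → Subset
  Span F X y =
    ∃[ k ] ∃ λ (c : Vector Carrier k) → ∃ λ (x : Vector Carrier k) →
      (∀ i → c i ∈ F × x i ∈ X) × y ≈ sum (λ i → c i * x i)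

  Range : ∀ {n} → Vector Carrier n → Subset
  Range v y = ∃[ i ] y ≈ v i

  RangeExcept : ∀ {n} → Fin n → Vector Carrier n → Subset
  RangeExcept i v y = ∃[ j ] j ≢ i × y ≈ v j

  LinearlyIndependent : ∀ {n} → Subset → Vector Carrier n → Set ℓ
  LinearlyIndependent {n} F v =
    ∀ (c : Vector Carrier n) → (∀ i → c i ∈ F) → sum (λ i → c i * v i) ≈ 0# → ∀ i → c i ≈ 0#

  record IsBasis {n} (F V : Subset) (v : Vector Carrier n) : Set ℓ where
    field
      members     : ∀ i → v i ∈ V
      spanning    : V ⊆ Span F (Range v)
      independent : LinearlyIndependent F v

  HasDim : (F V : Subset) → ℕ → Set ℓ
  HasDim F V n = ∃ λ (v : Vector Carrier n) → IsBasis F V v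

  infixr 8 _·_ _⁻¹·_

  _·_ : Carrier → Subset → Subset
  (a · V) y = ∃[ x ] x ∈ V × y ≈ a * x

  -- This is empty when a is not invertible; it is only used for members
  -- of a basis, which are nonzero.

  _⁻¹·_ : Carrier → Subset → Subset
  (a ⁻¹· V) y = ∃[ b ] a * b ≈ 1# × y ∈ b · V

  IsDirectSum : ∀ {k} → Subset → Vector Subset k → Set ℓ
  IsDirectSum {k} V W =
    (∀ y → y ∈ V ⇔ (∃ λ (w : Vector Carrier k) → (∀ i → w i ∈ W i) × y ≈ sum w)) ×
    (∀ (w w′ : Vector Carrier k) → (∀ i → w i ∈ W i) → (∀ i → w′ i ∈ W i) →
       sum w ≈ sum w′ → ∀ i → w i ≈ w′ i)

  BasisMatched : ∀ {n} (K A B : Subset) (a b : Vector Carrier n) → Set ℓ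
  BasisMatched K A B a b = ∀ i → ((a i ⁻¹· A) ∩ B) ⊆ Span K (RangeExcept i b)

  Matchable : ℕ → (K A B : Subset) → Set ℓ
  Matchable n K A B =
    ∀ (a : Vector Carrier n) → IsBasis K A a →
      ∃ λ (b : Vector Carrier n) → IsBasis K B b × BasisMatched K A B a b

  Unmatchable : ℕ → (K A B : Subset) → Set ℓ
  Unmatchable n K A B = ¬ Matchable n K A B

  record IsObstruction (K A B R S Y Z : Subset) (m : ℕ) (a : Vector Carrier m) : Set ℓ where
    field
      R-subspace : IsSubspace K R
      S-subspace : IsSubspace K S
      Y-subspace : IsSubspace K Y
      Z-subspace : IsSubspace K Z
      R⊆B        : R ⊆ B
      R-nonzero  : ∃[ r ] r ∈ R × ¬ (r ≈ 0#)
      A=S⊕Y      : IsDirectSum A (S ∷ Y ∷ [])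
      B=R⊕Z      : IsDirectSum B (R ∷ Z ∷ [])
      dimY<dimR  : ∃[ y ] ∃[ r ] HasDim K Y y × HasDim K R r × y < r
      a∈S        : ∀ i → a i ∈ S
      S=⊕aK⟮R⟯   : IsDirectSum S (λ i → a i · K ⟮ R ⟯)
      dimS=m     : HasDim (K ⟮ R ⟯) S m

{-# OPTIONS --safe #-}

-- For a basis a of A put V i = { b ∈ B : a i b ∈ A }.  By Rado's theorem (in the dual of B), a can be
-- matched unless dim ⋂_{i ∈ J} V i + |J| > n for some J.  In that case X = ⟨ a i : i ∈ J ⟩ and
-- U = ⋂_{i ∈ J} V i satisfy X U ⊆ A and dim X + dim U > n.  Dyson's transform preserves both properties
-- and lowers dim U until X U ⊆ X.  The elements t with t X ⊆ X form a field, because multiplication by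
-- t ≠ 0 is injective on the finite-dimensional X, so X is a K(U)-subspace: take S = X and R = U.
-- Conversely, if A = S ⊕ Y with R S ⊆ S, match a basis of A that starts with a basis of S: R is
-- contained in the span of dim Y vectors, whence dim R ≤ dim Y.

module Submission where

open import Algebra.Apartness.Bundles using (HeytingField)
open import Algebra.Bundles using (CommutativeRing)
open import Axiom.ExcludedMiddle using (ExcludedMiddle)
open import Data.Bool.Base using (true; false)
open import Data.Empty using (⊥; ⊥-elim)
open import Data.Fin.Base using (Fin; zero; suc; punchIn; _↑ˡ_; _↑ʳ_; splitAt; join)
import Data.Fin.Properties as Fin
import Data.Fin.Subset as FS
import Data.Fin.Subset.Properties as FS
import Data.List.Base as List
open import Data.List.Base using (List; allFin)
import Data.List.Membership.Propositional as List
open import Data.List.Membership.Propositional.Properties using (∈-allFin)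
open import Data.List.Relation.Unary.Any using (here; there)
import Data.Nat.Base as ℕ
open import Data.Nat.Base using (ℕ; zero; suc; _<_; _≤_; z≤n; s≤s)
import Data.Nat.Properties as ℕ
open import Data.Nat.Solver using (module +-*-Solver)
open import Data.Product.Base using (∃; ∃-syntax; _×_; _,_; proj₁; proj₂)
open import Data.Sum.Base using (_⊎_; inj₁; inj₂; [_,_]′)
import Data.Vec.Base as Vec
open import Data.Vec.Functional using (Vector; []; _∷_; head; tail; removeAt; updateAt; _++_)
open import Data.Vec.Functional.Properties
  using (updateAt-updates; updateAt-minimal; lookup-++ˡ; lookup-++ʳ)
open import Defs
open import Function.Base using (_∘_; const; id)
open import Function.Bundles using (_⇔_; mk⇔; Equivalence)
open import Level using () renaming (suc to lsuc)
open import Relation.Binary.PropositionalEquality.Core using (_≡_; refl; subst; _≢_)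
  renaming (sym to ≡-sym; cong to ≡-cong; trans to ≡-trans)
open import Relation.Nullary.Decidable.Core using (Dec; yes; no; decidable-stable)
open import Relation.Nullary.Negation.Core using (¬_; contradiction)
open import Relation.Unary using (_∈_; _⊆_)

-- Finite subsets

-- Why the dual: a basis b of B with each V i in the span of the b j, j ≠ i, is dual to independent
-- functionals φ i that vanish on V i, so a matching is an independent transversal of the
-- annihilators of the V i. The proof works with the kernels of the φ i, hyperplanes of B, and forms
-- no dual or quotient space. Their place is taken by the relative dimension of a pair of subspaces,
-- a chain of one-vector extensions. It suits arbitrary predicates on L, whose dimensions are
-- obtained by excluded middle, and one isomorphism, Q / W ≅ (P + eQ) / (P + eW), then serves the
-- modular law, Dyson's transform, direct sums and towers of fields alike. A violation is counted in
-- B: dim U + |J| > n = dim B, where |J| = dim X because the a i are independent. Since also n = dim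
-- A, it says n - dim X < dim U, and n - dim X is the dimension of a complement of X in A. This is
-- the origin of dim Y < dim R.

∣p∪q∣+∣p∩q∣≡∣p∣+∣q∣ : ∀ {n} (p q : FS.Subset n) → FS.∣ p FS.∪ q ∣ ℕ.+ FS.∣ p FS.∩ q ∣ ≡ FS.∣ p ∣ ℕ.+ FS.∣ q ∣
∣p∪q∣+∣p∩q∣≡∣p∣+∣q∣ Vec.[] Vec.[]          = refl
∣p∪q∣+∣p∩q∣≡∣p∣+∣q∣ (true  Vec.∷ p) (true  Vec.∷ q) = ≡-cong suc (≡-trans (ℕ.+-suc _ _)
  (≡-trans (≡-cong suc (∣p∪q∣+∣p∩q∣≡∣p∣+∣q∣ p q)) (≡-sym (ℕ.+-suc _ _))))
∣p∪q∣+∣p∩q∣≡∣p∣+∣q∣ (true  Vec.∷ p) (false Vec.∷ q) = ≡-cong suc (∣p∪q∣+∣p∩q∣≡∣p∣+∣q∣ p q)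
∣p∪q∣+∣p∩q∣≡∣p∣+∣q∣ (false Vec.∷ p) (true  Vec.∷ q) =
  ≡-trans (≡-cong suc (∣p∪q∣+∣p∩q∣≡∣p∣+∣q∣ p q)) (≡-sym (ℕ.+-suc _ _))
∣p∪q∣+∣p∩q∣≡∣p∣+∣q∣ (false Vec.∷ p) (false Vec.∷ q) = ∣p∪q∣+∣p∩q∣≡∣p∣+∣q∣ p q

infixl 8 _∖_

_∖_ : ∀ {n} → FS.Subset n → Fin n → FS.Subset n
p ∖ i = p FS.∩ FS.∁ FS.⁅ i ⁆

∈-∖⁻ : ∀ {n} (p : FS.Subset n) {i j} → j FS.∈ p ∖ i → j FS.∈ p × j ≢ i
∈-∖⁻ p {i} {j} j∈ = proj₁ (FS.x∈p∩q⁻ p _ j∈) ,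
  λ j≡i → FS.x∈∁p⇒x∉p (proj₂ (FS.x∈p∩q⁻ p _ j∈)) (subst (FS._∈ FS.⁅ i ⁆) (≡-sym j≡i) (FS.x∈⁅x⁆ i))

∈-∖⁺ : ∀ {n} {p : FS.Subset n} {i j} → j FS.∈ p → j ≢ i → j FS.∈ p ∖ i
∈-∖⁺ j∈p j≢i = FS.x∈p∩q⁺ (j∈p , FS.x∉p⇒x∈∁p (FS.x≢y⇒x∉⁅y⁆ j≢i))

∣p∖i∣<∣p∣ : ∀ {n} {p : FS.Subset n} {i} → i FS.∈ p → FS.∣ p ∖ i ∣ < FS.∣ p ∣
∣p∖i∣<∣p∣ {p = p} {i} i∈p = FS.p⊂q⇒∣p∣<∣q∣ (FS.p∩q⊆p p _ , i , i∈p , λ i∈ → proj₂ (∈-∖⁻ p i∈) refl)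

∣p∣≤1+∣p∖i∣ : ∀ {n} (p : FS.Subset n) i → FS.∣ p ∣ ≤ suc FS.∣ p ∖ i ∣
∣p∣≤1+∣p∖i∣ {n} p i = begin
  FS.∣ p ∣                            ≤⟨ FS.p⊆q⇒∣p∣≤∣q∣ p⊆ ⟩
  FS.∣ ⁅i⁆ FS.∪ p ∖ i ∣               ≤⟨ ℕ.m≤m+n _ _ ⟩
  FS.∣ ⁅i⁆ FS.∪ p ∖ i ∣ ℕ.+ FS.∣ ⁅i⁆ FS.∩ p ∖ i ∣ ≡⟨ ∣p∪q∣+∣p∩q∣≡∣p∣+∣q∣ ⁅i⁆ (p ∖ i) ⟩
  FS.∣ ⁅i⁆ ∣ ℕ.+ FS.∣ p ∖ i ∣         ≡⟨ ≡-cong (ℕ._+ FS.∣ p ∖ i ∣) (FS.∣⁅x⁆∣≡1 i) ⟩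
  suc FS.∣ p ∖ i ∣                    ∎
  where
  open ℕ.≤-Reasoning
  ⁅i⁆ = FS.⁅ i ⁆

  p⊆ : p FS.⊆ ⁅i⁆ FS.∪ p ∖ i
  p⊆ {j} j∈p with j Fin.≟ i
  ... | yes refl = FS.x∈p∪q⁺ {p = ⁅i⁆} (inj₁ (FS.x∈⁅x⁆ i))
  ... | no j≢i   = FS.x∈p∪q⁺ {p = ⁅i⁆} (inj₂ (∈-∖⁺ j∈p j≢i))

-- The arithmetic of `hall-dichotomy`: p, q are the dimensions of the meets P, Q over violating sets
-- I, J of a, b elements; d = dim (P ∩ Q), p + c = dim (P + Q), u = |I ∪ J|, v = |I ∩ J|, and w is v
-- after the removal of one index. The violations add up to at least 2n + 2, the two Hall bounds
-- allow 2n, and the removed index accounts for only 1.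
submodularity-contradiction : ∀ {n p q d c a b u v w} →
  n < p ℕ.+ a → n < q ℕ.+ b → d ℕ.+ c ≡ q → u ℕ.+ v ≡ a ℕ.+ b →
  d ℕ.+ u ≤ n → v ≤ suc w → (p ℕ.+ c) ℕ.+ w ≤ n → ⊥
submodularity-contradiction {n} {p} {q} {d} {c} {a} {b} {u} {v} {w} n<p+a n<q+b refl u+v≡a+b d+u≤n v≤1+w s+w≤n =
  ℕ.<-irrefl refl (begin-strict
    suc n ℕ.+ suc n                        ≤⟨ ℕ.+-mono-≤ n<p+a n<q+b ⟩
    (p ℕ.+ a) ℕ.+ ((d ℕ.+ c) ℕ.+ b)        ≡⟨ solve 5 (λ p a d c b →
      (p :+ a) :+ ((d :+ c) :+ b) := (d :+ (p :+ c)) :+ (a :+ b)) refl p a d c b ⟩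
    (d ℕ.+ (p ℕ.+ c)) ℕ.+ (a ℕ.+ b)        ≡⟨ ≡-cong ((d ℕ.+ (p ℕ.+ c)) ℕ.+_) (≡-sym u+v≡a+b) ⟩
    (d ℕ.+ (p ℕ.+ c)) ℕ.+ (u ℕ.+ v)        ≡⟨ solve 4 (λ d s u v →
      (d :+ s) :+ (u :+ v) := (d :+ u) :+ (s :+ v)) refl d (p ℕ.+ c) u v ⟩
    (d ℕ.+ u) ℕ.+ ((p ℕ.+ c) ℕ.+ v)        ≤⟨ ℕ.+-mono-≤ d+u≤n (ℕ.+-monoʳ-≤ (p ℕ.+ c) v≤1+w) ⟩
    n ℕ.+ ((p ℕ.+ c) ℕ.+ suc w)            ≡⟨ ≡-cong (n ℕ.+_) (ℕ.+-suc (p ℕ.+ c) w) ⟩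
    n ℕ.+ suc ((p ℕ.+ c) ℕ.+ w)            ≤⟨ ℕ.+-monoʳ-≤ n (s≤s s+w≤n) ⟩
    n ℕ.+ suc n                            <⟨ ℕ.n<1+n _ ⟩
    suc n ℕ.+ suc n                        ∎)
  where
  open ℕ.≤-Reasoning
  open +-*-Solver

-- Arithmetic in L

module FieldProperties {ℓ} (em : ExcludedMiddle ℓ) (L : HeytingField ℓ ℓ ℓ) where

  open HeytingField L hiding (refl; zero) public
  open HeytingField L using () renaming (refl to ≈-refl) public
  open Extension L using (sum) public

  commutativeRing : CommutativeRing ℓ ℓ
  commutativeRing = record { isCommutativeRing = isCommutativeRing }

  open CommutativeRing commutativeRing using (ring; semiring; commutativeSemiring)
  open import Algebra.Properties.Ring ring public
    using (-1*x≈-x; -‿distribˡ-*; -‿distribʳ-*; -0#≈0#; \\-leftDividesʳ; x∙y⁻¹≈ε⇒x≈y)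
  open import Relation.Binary.Reasoning.Setoid setoid public
  open import Algebra.Solver.Ring.NaturalCoefficients.Default commutativeSemiring public
    using (solve; _:=_; _:+_; _:*_)
  open import Algebra.Properties.CommutativeMonoid.Sum (Extension.+-commutativeMonoid L) public
    using (sum-cong-≋; sum-remove; ∑-distrib-+; sum-replicate-zero)
  open import Algebra.Properties.Semiring.Sum semiring public
    using (*-distribˡ-sum)

  -- If 1 ≈ 0, then 0 - 0 is invertible with inverse 0, so 0 is apart from itself.
  1≉0 : ¬ (1# ≈ 0#)
  1≉0 1≈0 = #-irrefl ≈-refl (invertible⇒# (0# , trivial , trans (*-comm _ _) trivial))
    where
    trivial : 0# * (0# - 0#) ≈ 1#
    trivial = trans (zeroˡ _) (sym 1≈0)

  -- Inverses come from apartness; excluded middle and tightness supply it when x is merely unequal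
  -- to 0.
  inverse : ∀ {x} → ¬ (x ≈ 0#) → ∃[ y ] x * y ≈ 1#
  inverse {x} x≉0 with em {x # 0#}
  ... | no ¬x#0 = contradiction (proj₁ (tight x 0#) ¬x#0) x≉0
  ... | yes x#0 with #⇒invertible x#0
  ...   | y , _ , eq = y , trans (*-congʳ (sym (trans (+-congˡ -0#≈0#) (+-identityʳ x)))) eq

  inverse≉0 : ∀ {x y} → x * y ≈ 1# → ¬ (y ≈ 0#)
  inverse≉0 {x} xy≈1 y≈0 = 1≉0 (trans (sym xy≈1) (trans (*-congˡ y≈0) (zeroʳ x)))

  x-factor : ∀ {x y} z → x * y ≈ 1# → y * (x * z) ≈ z
  x-factor {x} {y} z xy≈1 = begin
    y * (x * z)  ≈⟨ solve 3 (λ x y z → y :* (x :* z) := (x :* y) :* z) ≈-refl x y z ⟩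
    (x * y) * z  ≈⟨ *-congʳ xy≈1 ⟩
    1# * z       ≈⟨ *-identityˡ z ⟩
    z            ∎

  x≉0∧x*y≈0⇒y≈0 : ∀ {x y} → ¬ (x ≈ 0#) → x * y ≈ 0# → y ≈ 0#
  x≉0∧x*y≈0⇒y≈0 {x} {y} x≉0 xy≈0 with inverse x≉0
  ... | x⁻¹ , eq = trans (sym (x-factor y eq)) (trans (*-congˡ xy≈0) (zeroʳ x⁻¹))

  sum-++ : ∀ m {n} (f : Vector Carrier (m ℕ.+ n)) →
           sum f ≈ sum (λ i → f (i ↑ˡ n)) + sum (λ i → f (m ↑ʳ i))
  sum-++ zero    f = sym (+-identityˡ _)
  sum-++ (suc m) f = trans (+-congˡ (sum-++ m (tail f))) (sym (+-assoc _ _ _))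

  sum-≈0 : ∀ {n} (f : Vector Carrier n) → (∀ i → f i ≈ 0#) → sum f ≈ 0#
  sum-≈0 {n} f f≈0 = trans (sum-cong-≋ f≈0) (sum-replicate-zero n)

-- Linear algebra over a subfield

module LinearAlgebra {ℓ} (em : ExcludedMiddle ℓ) (L : HeytingField ℓ ℓ ℓ)
  (F : Extension.Subset L) (F-isSubfield : Extension.IsSubfield L F) where

  open FieldProperties em L
  open Extension L hiding (sum; cong)
  module F = IsSubfield F-isSubfield

  -- Subspaces and relative dimension

  record Subspace : Set (lsuc ℓ) where
    constructor ⟪_,_⟫
    field
      members    : Subset
      isSubspace : IsSubspace F members
    open IsSubspace isSubspace public

  open Subspace using (members)

  infix 4 _∈ˢ_ _∉ˢ_ _⊑_

  _∈ˢ_ _∉ˢ_ : Carrier → Subspace → Set ℓ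
  x ∈ˢ V = members V x
  x ∉ˢ V = ¬ (x ∈ˢ V)

  _⊑_ : Subspace → Subspace → Set ℓ
  V ⊑ W = ∀ {x} → x ∈ˢ V → x ∈ˢ W

  module _ (V : Subspace) where
    open Subspace V

    neg-closed : ∀ {x} → x ∈ˢ V → - x ∈ˢ V
    neg-closed x∈V = resp (-1*x≈-x _) (*-closed (F.-‿closed F.1-closed) x∈V)

    +-cancelˡ-∈ : ∀ {x y} → x ∈ˢ V → x + y ∈ˢ V → y ∈ˢ V
    +-cancelˡ-∈ x∈V x+y∈V = resp (\\-leftDividesʳ _ _) (+-closed (neg-closed x∈V) x+y∈V)

    *-cancelˡ-∈ : ∀ {c x} → c ∈ F → ¬ (c ≈ 0#) → c * x ∈ˢ V → x ∈ˢ V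
    *-cancelˡ-∈ c∈F c≉0 cx∈V with inverse c≉0
    ... | c⁻¹ , eq = resp (x-factor _ eq) (*-closed (F.⁻¹-closed c∈F eq) cx∈V)

    sum-closed : ∀ {n} (f : Vector Carrier n) → (∀ i → f i ∈ˢ V) → sum f ∈ˢ V
    sum-closed {zero}  f f∈V = 0-closed
    sum-closed {suc n} f f∈V = +-closed (f∈V zero) (sum-closed (tail f) (f∈V ∘ suc))

    term-closed : ∀ {n} (f : Vector Carrier n) i → (∀ j → j ≢ i → f j ∈ˢ V) → sum f ∈ˢ V → f i ∈ˢ V
    term-closed {suc n} f i f∈V sum∈V = +-cancelˡ-∈
      (sum-closed (removeAt f i) (λ j → f∈V (punchIn i j) (Fin.punchInᵢ≢i i j)))
      (resp (trans (sum-remove {i = i} f) (+-comm _ _)) sum∈V)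

    Span-least : ∀ {X : Subset} → X ⊆ members V → Span F X ⊆ members V
    Span-least X⊆V (_ , c , x , c∈F,x∈X , y≈) =
      resp (sym y≈) (sum-closed _ λ i → *-closed (proj₁ (c∈F,x∈X i)) (X⊆V (proj₂ (c∈F,x∈X i))))

  𝟘 𝔽 : Subspace
  𝟘 = ⟪ _≈ 0# , record
    { resp     = λ x≈y x≈0 → trans (sym x≈y) x≈0
    ; 0-closed = ≈-refl
    ; +-closed = λ x≈0 y≈0 → trans (+-cong x≈0 y≈0) (+-identityˡ 0#)
    ; *-closed = λ {c} _ x≈0 → trans (*-congˡ x≈0) (zeroʳ c)
    } ⟫
  𝔽 = ⟪ F , record
    { resp = F.resp ; 0-closed = F.0-closed ; +-closed = F.+-closed ; *-closed = F.*-closed } ⟫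

  infixl 6 _⊞_ _⊹_
  infixl 7 _⊓_
  infixr 8 _◃_

  _⊓_ : Subspace → Subspace → Subspace
  V ⊓ W = ⟪ (λ x → x ∈ˢ V × x ∈ˢ W) , record
    { resp     = λ x≈y (x∈V , x∈W) → V.resp x≈y x∈V , W.resp x≈y x∈W
    ; 0-closed = V.0-closed , W.0-closed
    ; +-closed = λ (x∈V , x∈W) (y∈V , y∈W) → V.+-closed x∈V y∈V , W.+-closed x∈W y∈W
    ; *-closed = λ c∈F (x∈V , x∈W) → V.*-closed c∈F x∈V , W.*-closed c∈F x∈W
    } ⟫
    where
    module V = Subspace V
    module W = Subspace W

  _⊞_ : Subspace → Subspace → Subspace
  V ⊞ W = ⟪ (λ x → ∃[ v ] ∃[ w ] v ∈ˢ V × w ∈ˢ W × x ≈ v + w) , record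
    { resp     = λ x≈y (v , w , v∈V , w∈W , x≈) → v , w , v∈V , w∈W , trans (sym x≈y) x≈
    ; 0-closed = 0# , 0# , V.0-closed , W.0-closed , sym (+-identityˡ 0#)
    ; +-closed = λ (v , w , v∈V , w∈W , x≈) (v′ , w′ , v′∈V , w′∈W , y≈) →
        v + v′ , w + w′ , V.+-closed v∈V v′∈V , W.+-closed w∈W w′∈W ,
        trans (+-cong x≈ y≈)
          (solve 4 (λ a b c d → (a :+ b) :+ (c :+ d) := (a :+ c) :+ (b :+ d)) ≈-refl v w v′ w′)
    ; *-closed = λ {c} c∈F (v , w , v∈V , w∈W , x≈) →
        c * v , c * w , V.*-closed c∈F v∈V , W.*-closed c∈F w∈W ,
        trans (*-congˡ x≈) (distribˡ c v w)
    } ⟫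
    where
    module V = Subspace V
    module W = Subspace W

  _◃_ : Carrier → Subspace → Subspace
  e ◃ V = ⟪ e · members V , record
    { resp     = λ x≈y (v , v∈V , x≈) → v , v∈V , trans (sym x≈y) x≈
    ; 0-closed = 0# , V.0-closed , sym (zeroʳ e)
    ; +-closed = λ (v , v∈V , x≈) (v′ , v′∈V , y≈) →
        v + v′ , V.+-closed v∈V v′∈V , trans (+-cong x≈ y≈) (sym (distribˡ e v v′))
    ; *-closed = λ {c} c∈F (v , v∈V , x≈) →
        c * v , V.*-closed c∈F v∈V ,
        trans (*-congˡ x≈) (solve 3 (λ c e v → c :* (e :* v) := e :* (c :* v)) ≈-refl c e v)
    } ⟫
    where module V = Subspace V

  -- The preimage of V under multiplication by e. It is e⁻¹V when e ≠ 0 and makes sense for e = 0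
  -- too, so no inverse has to be carried along.
  _∶_ : Subspace → Carrier → Subspace
  V ∶ e = ⟪ (λ x → e * x ∈ˢ V) , record
    { resp     = λ x≈y → V.resp (*-congˡ x≈y)
    ; 0-closed = V.resp (sym (zeroʳ e)) V.0-closed
    ; +-closed = λ x∈ y∈ → V.resp (sym (distribˡ e _ _)) (V.+-closed x∈ y∈)
    ; *-closed = λ {c} {x} c∈F x∈ →
        V.resp (solve 3 (λ c e v → c :* (e :* v) := e :* (c :* v)) ≈-refl c e x) (V.*-closed c∈F x∈)
    } ⟫
    where module V = Subspace V

  _⊹_ : Subspace → Carrier → Subspace
  W ⊹ x = W ⊞ x ◃ 𝔽

  ⊑-⊞ˡ : ∀ V W → V ⊑ V ⊞ W
  ⊑-⊞ˡ V W {x} x∈V = x , 0# , x∈V , Subspace.0-closed W , sym (+-identityʳ x)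

  ⊑-⊞ʳ : ∀ V W → W ⊑ V ⊞ W
  ⊑-⊞ʳ V W {x} x∈W = 0# , x , Subspace.0-closed V , x∈W , sym (+-identityˡ x)

  ⊞-least : ∀ U V W → U ⊑ W → V ⊑ W → U ⊞ V ⊑ W
  ⊞-least U V W U⊑W V⊑W (u , v , u∈U , v∈V , x≈) = Subspace.resp W (sym x≈) (Subspace.+-closed W (U⊑W u∈U) (V⊑W v∈V))

  x∈W⊹x : ∀ W x → x ∈ˢ W ⊹ x
  x∈W⊹x W x = ⊑-⊞ʳ W (x ◃ 𝔽) (1# , F.1-closed , sym (*-identityʳ x))

  ◃𝔽-least : ∀ {x} V → x ∈ˢ V → x ◃ 𝔽 ⊑ V
  ◃𝔽-least V x∈V (c , c∈F , y≈) = Subspace.resp V (sym (trans y≈ (*-comm _ c))) (Subspace.*-closed V c∈F x∈V)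

  ⊹-least : ∀ W {x} V → W ⊑ V → x ∈ˢ V → W ⊹ x ⊑ V
  ⊹-least W {x} V W⊑V x∈V = ⊞-least W (x ◃ 𝔽) V W⊑V (◃𝔽-least V x∈V)

  ⊹-mono : ∀ V W x → V ⊑ W → V ⊹ x ⊑ W ⊹ x
  ⊹-mono V W x V⊑W = ⊹-least V (W ⊹ x) (⊑-⊞ˡ W (x ◃ 𝔽) ∘ V⊑W) (x∈W⊹x W x)

  ⊹-swap : ∀ W x y → W ⊹ x ⊹ y ⊑ W ⊹ y ⊹ x
  ⊹-swap W x y = ⊹-least (W ⊹ x) (W ⊹ y ⊹ x)
    (⊹-mono W (W ⊹ y) x (⊑-⊞ˡ W (y ◃ 𝔽)))
    (⊑-⊞ˡ (W ⊹ y) (x ◃ 𝔽) (x∈W⊹x W y))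

  ⊹-exchange : ∀ W {x y} → y ∈ˢ W ⊹ x → y ∉ˢ W → x ∈ˢ W ⊹ y
  ⊹-exchange W {x} {y} (w , z , w∈W , (c , c∈F , z≈) , y≈) y∉W =
    *-cancelˡ-∈ (W ⊹ y) c∈F c≉0 (Subspace.resp (W ⊹ y) (trans z≈ (*-comm x c))
      (+-cancelˡ-∈ (W ⊹ y) (⊑-⊞ˡ W (y ◃ 𝔽) w∈W) (Subspace.resp (W ⊹ y) y≈ (x∈W⊹x W y))))
    where
    c≉0 : ¬ (c ≈ 0#)
    c≉0 c≈0 = y∉W (Subspace.resp W (sym (begin
      y          ≈⟨ y≈ ⟩
      w + z      ≈⟨ +-congˡ (trans z≈ (trans (*-congˡ c≈0) (zeroʳ x))) ⟩
      w + 0#     ≈⟨ +-identityʳ w ⟩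
      w          ∎)) w∈W)

  -- dim (V + W) / W, as the length of a chain W ⊂ W + F x₁ ⊂ W + F x₁ + F x₂ ⊂ … ending above V.
  data Codim (V W : Subspace) : ℕ → Set ℓ where
    done : V ⊑ W → Codim V W 0
    step : ∀ {n} x → x ∈ˢ V → x ∉ˢ W → Codim V (W ⊹ x) n → Codim V W (suc n)

  Dim : Subspace → ℕ → Set ℓ
  Dim V = Codim V 𝟘

  codim-resp : ∀ {V V′ W W′ n} → V ⊑ V′ → V′ ⊑ V → W ⊑ W′ → W′ ⊑ W → Codim V W n → Codim V′ W′ n
  codim-resp V⊑V′ V′⊑V W⊑W′ W′⊑W (done V⊑W) = done (λ x∈V′ → W⊑W′ (V⊑W (V′⊑V x∈V′)))
  codim-resp {W = W} {W′} V⊑V′ V′⊑V W⊑W′ W′⊑W (step x x∈V x∉W c) =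
    step x (V⊑V′ x∈V) (x∉W ∘ W′⊑W)
      (codim-resp V⊑V′ V′⊑V (⊹-mono W W′ x W⊑W′) (⊹-mono W′ W x W′⊑W) c)

  -- Steinitz exchange, by induction on the chain. If x lies in W + F y, then W + F x = W + F y;
  -- otherwise x is moved to the front of the chain above W + F y, and x and y change places.
  codim-exchange : ∀ {V W n x} → x ∈ˢ V → x ∉ˢ W → Codim V W (suc n) → Codim V (W ⊹ x) n
  codim-exchange {V} {W} {n} {x} x∈V x∉W (step y y∈V y∉W c) = by-cases em c
    where
    by-cases : ∀ {n} → Dec (x ∈ˢ W ⊹ y) → Codim V (W ⊹ y) n → Codim V (W ⊹ x) n
    by-cases (yes x∈W⊹y) c = codim-resp id id
      (⊹-least W (W ⊹ x) (⊑-⊞ˡ W (x ◃ 𝔽)) (⊹-exchange W x∈W⊹y x∉W))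
      (⊹-least W (W ⊹ y) (⊑-⊞ˡ W (y ◃ 𝔽)) x∈W⊹y) c
    by-cases (no x∉W⊹y) (done V⊑W⊹y) = contradiction (V⊑W⊹y x∈V) x∉W⊹y
    by-cases (no x∉W⊹y) c@(step _ _ _ _) =
      step y y∈V (λ y∈ → x∉W⊹y (⊹-exchange W y∈ y∉W))
        (codim-resp id id (⊹-swap W y x) (⊹-swap W x y) (codim-exchange x∈V x∉W⊹y c))

  -- The first vector of the second chain lies in V outside W, so by exchange it can also start the
  -- first chain, and both chains shrink by one.
  codim-mono : ∀ {V V′ W W′ m n} → Codim V W m → V′ ⊑ V → W ⊑ W′ → Codim V′ W′ n → n ≤ m
  codim-mono c V′⊑V W⊑W′ (done _) = z≤n
  codim-mono (done V⊑W) V′⊑V W⊑W′ (step x x∈V′ x∉W′ c′) = contradiction (W⊑W′ (V⊑W (V′⊑V x∈V′))) x∉W′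
  codim-mono {W = W} {W′} c@(step _ _ _ _) V′⊑V W⊑W′ (step x x∈V′ x∉W′ c′) =
    s≤s (codim-mono (codim-exchange (V′⊑V x∈V′) (x∉W′ ∘ W⊑W′) c) V′⊑V (⊹-mono W W′ x W⊑W′) c′)

  -- Vectors of V′ outside W′ are picked as long as excluded middle finds one; each uses up a step
  -- of the given chain, so there are at most m picks.
  codim-exists : ∀ {V V′ W W′} m → Codim V W m → V′ ⊑ V → W ⊑ W′ → ∃ (Codim V′ W′)
  codim-exists {V} {V′} {W} {W′} m c V′⊑V W⊑W′ = by-cases m c em
    where
    by-cases : ∀ m → Codim V W m → Dec (∃[ x ] x ∈ˢ V′ × x ∉ˢ W′) → ∃ (Codim V′ W′)
    by-cases _ _ (no none) =
      0 , done (λ {x} x∈V′ → decidable-stable em (λ x∉W′ → none (x , x∈V′ , x∉W′)))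
    by-cases zero (done V⊑W) (yes (x , x∈V′ , x∉W′)) =
      contradiction (W⊑W′ (V⊑W (V′⊑V x∈V′))) x∉W′
    by-cases (suc m) c (yes (x , x∈V′ , x∉W′)) =
      let n , c′ = codim-exists m (codim-exchange (V′⊑V x∈V′) (x∉W′ ∘ W⊑W′) c) V′⊑V (⊹-mono W W′ x W⊑W′)
      in suc n , step x x∈V′ x∉W′ c′

  codim-trans : ∀ {U V W m n} → Codim V W m → Codim U V n → W ⊑ V → V ⊑ U → Codim U W (m ℕ.+ n)
  codim-trans (done V⊑W) c W⊑V V⊑U = codim-resp id id V⊑W W⊑V c
  codim-trans {V = V} {W} (step x x∈V x∉W c) c′ W⊑V V⊑U =
    step x (V⊑U x∈V) x∉W (codim-trans c c′ (⊹-least W V W⊑V x∈V) V⊑U)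

  codim-unique : ∀ {V W m n} → Codim V W m → Codim V W n → m ≡ n
  codim-unique c c′ = ℕ.≤-antisym (codim-mono c′ id id c) (codim-mono c id id c′)

  codim-0 : ∀ {V W n} → V ⊑ W → Codim V W n → n ≡ 0
  codim-0 V⊑W c = codim-unique c (done V⊑W)

  codim-full : ∀ {V V′ W n} → Codim V W n → Codim V′ W n → V′ ⊑ V → W ⊑ V′ → V ⊑ V′
  codim-full {n = n} c c′ V′⊑V W⊑V′ with codim-exists n c id W⊑V′
  ... | zero  , done V⊑V′ = V⊑V′
  ... | suc k , c″ = contradiction (codim-unique (codim-trans c′ c″ W⊑V′ V′⊑V) c) (ℕ.m+1+n≢m n)

  -- The isomorphism Q / W ≅ (P + eQ) / (P + eW); for e = 1 and W = P ∩ Q it is the modular law.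
  codim-⊞ : ∀ {P Q W} e {n} → W ⊑ Q → (∀ {q} → q ∈ˢ Q → e * q ∈ˢ P → q ∈ˢ W) →
            Codim Q W n → Codim (P ⊞ e ◃ Q) (P ⊞ e ◃ W) n
  codim-⊞ {P} {Q} {W} e W⊑Q inj (done Q⊑W) = done (⊞-least P (e ◃ Q) (P ⊞ e ◃ W) (⊑-⊞ˡ P (e ◃ W))
    λ (q , q∈Q , x≈) → ⊑-⊞ʳ P (e ◃ W) (q , Q⊑W q∈Q , x≈))
  codim-⊞ {P} {Q} {W} e W⊑Q inj (step x x∈Q x∉W c) =
    step (e * x) (⊑-⊞ʳ P (e ◃ Q) (x , x∈Q , ≈-refl)) ex∉
      (codim-resp id id forth back
        (codim-⊞ {P} e (⊹-least W Q W⊑Q x∈Q) (λ q∈Q eq∈P → ⊑-⊞ˡ W (x ◃ 𝔽) (inj q∈Q eq∈P)) c))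
    where
    P+eW = P ⊞ e ◃ W

    ex∉ : e * x ∉ˢ P+eW
    ex∉ (p , z , p∈P , (w , w∈W , z≈) , ex≈) = x∉W (+-cancelˡ-∈ W (neg-closed W w∈W)
      (inj (Subspace.+-closed Q (neg-closed Q (W⊑Q w∈W)) x∈Q) (Subspace.resp P (sym (begin
        e * (- w + x)      ≈⟨ distribˡ e (- w) x ⟩
        e * - w + e * x    ≈⟨ +-cong (sym (-‿distribʳ-* e w)) (trans ex≈ (+-comm p z)) ⟩
        - (e * w) + (z + p) ≈⟨ +-congʳ (-‿cong (sym z≈)) ⟩
        - z + (z + p)      ≈⟨ \\-leftDividesʳ z p ⟩
        p                  ∎)) p∈P)))

    forth : P ⊞ e ◃ (W ⊹ x) ⊑ P+eW ⊹ (e * x)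
    forth = ⊞-least P (e ◃ (W ⊹ x)) (P+eW ⊹ (e * x)) (⊑-⊞ˡ P+eW ((e * x) ◃ 𝔽) ∘ ⊑-⊞ˡ P (e ◃ W))
      λ (q , (w , z , w∈W , (c , c∈F , z≈) , q≈) , y≈) →
        e * w , e * x * c , ⊑-⊞ʳ P (e ◃ W) (w , w∈W , ≈-refl) , (c , c∈F , ≈-refl) ,
        (begin
          _                  ≈⟨ trans y≈ (*-congˡ q≈) ⟩
          e * (w + z)        ≈⟨ *-congˡ (+-congˡ z≈) ⟩
          e * (w + x * c)    ≈⟨ solve 4 (λ e w x c → e :* (w :+ x :* c) := e :* w :+ (e :* x) :* c) ≈-refl e w x c ⟩
          e * w + e * x * c  ∎)

    back : P+eW ⊹ (e * x) ⊑ P ⊞ e ◃ (W ⊹ x)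
    back = ⊹-least P+eW (P ⊞ e ◃ (W ⊹ x))
      (⊞-least P (e ◃ W) (P ⊞ e ◃ (W ⊹ x)) (⊑-⊞ˡ P (e ◃ (W ⊹ x)))
        λ (w , w∈W , y≈) → ⊑-⊞ʳ P (e ◃ (W ⊹ x)) (w , ⊑-⊞ˡ W (x ◃ 𝔽) w∈W , y≈))
      (⊑-⊞ʳ P (e ◃ (W ⊹ x)) (x , x∈W⊹x W x , ≈-refl))

  -- Linear combinations and bases modulo a subspace

  comb : ∀ {n} (c v : Vector Carrier n) → Carrier
  comb c v = sum (λ i → c i * v i)

  comb-0ˡ : ∀ {n} (c v : Vector Carrier n) → (∀ i → c i ≈ 0#) → comb c v ≈ 0#
  comb-0ˡ c v c≈0 = sum-≈0 _ (λ i → trans (*-congʳ (c≈0 i)) (zeroˡ (v i)))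

  comb-+ : ∀ {n} (c d v : Vector Carrier n) → comb (λ i → c i + d i) v ≈ comb c v + comb d v
  comb-+ c d v = trans (sum-cong-≋ (λ i → distribʳ (v i) (c i) (d i))) (∑-distrib-+ (λ i → c i * v i) (λ i → d i * v i))

  comb-* : ∀ {n} e (c v : Vector Carrier n) → comb (λ i → e * c i) v ≈ e * comb c v
  comb-* e c v = trans (sum-cong-≋ (λ i → *-assoc e (c i) (v i))) (sym (*-distribˡ-sum e (λ i → c i * v i)))

  unit : ∀ {n} → Fin n → Vector Carrier n
  unit zero    = 1# ∷ const 0#
  unit (suc i) = 0# ∷ unit i

  unit-closed : ∀ {n} (i j : Fin n) → unit i j ∈ F
  unit-closed zero    zero    = F.1-closed
  unit-closed zero    (suc j) = F.0-closed
  unit-closed (suc i) zero    = F.0-closed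
  unit-closed (suc i) (suc j) = unit-closed i j

  unit-diag : ∀ {n} (i : Fin n) → unit i i ≈ 1#
  unit-diag zero    = ≈-refl
  unit-diag (suc i) = unit-diag i

  comb-unit : ∀ {n} i (v : Vector Carrier n) → comb (unit i) v ≈ v i
  comb-unit zero v = trans (+-cong (*-identityˡ _) (comb-0ˡ (const 0#) (tail v) (λ _ → ≈-refl))) (+-identityʳ _)
  comb-unit (suc i) v = trans (+-cong (zeroˡ _) (comb-unit i (tail v))) (+-identityˡ _)

  -- One coefficient per index of v, so that coordinates make sense; `Span F (Range v)` admits lists
  -- of any length with repetitions.
  LSpan : ∀ {n} → Vector Carrier n → Subspace
  LSpan {n} v = ⟪ (λ y → ∃ λ (c : Vector Carrier n) → (∀ i → c i ∈ F) × y ≈ comb c v) , record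
    { resp     = λ x≈y (c , c∈F , x≈) → c , c∈F , trans (sym x≈y) x≈
    ; 0-closed = const 0# , (λ _ → F.0-closed) , sym (comb-0ˡ (const 0#) v (λ _ → ≈-refl))
    ; +-closed = λ (c , c∈F , x≈) (d , d∈F , y≈) →
        (λ i → c i + d i) , (λ i → F.+-closed (c∈F i) (d∈F i)) ,
        trans (+-cong x≈ y≈) (sym (comb-+ c d v))
    ; *-closed = λ {e} e∈F (c , c∈F , x≈) →
        (λ i → e * c i) , (λ i → F.*-closed e∈F (c∈F i)) ,
        trans (*-congˡ x≈) (sym (comb-* e c v))
    } ⟫

  ∈-LSpan : ∀ {n} (v : Vector Carrier n) i → v i ∈ˢ LSpan v
  ∈-LSpan v i = unit i , unit-closed i , sym (comb-unit i v)

  comb-closed : ∀ V {n} {c v : Vector Carrier n} → (∀ i → c i ∈ F) → (∀ i → v i ∈ˢ V) → comb c v ∈ˢ V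
  comb-closed V c∈F v∈V = sum-closed V _ (λ i → Subspace.*-closed V (c∈F i) (v∈V i))

  LSpan-least : ∀ {n} V (v : Vector Carrier n) → (∀ i → v i ∈ˢ V) → LSpan v ⊑ V
  LSpan-least V v v∈V (c , c∈F , y≈) = Subspace.resp V (sym y≈) (comb-closed V c∈F v∈V)

  LSpan⊆Span : ∀ {n} (v : Vector Carrier n) → members (LSpan v) ⊆ Span F (Range v)
  LSpan⊆Span {n} v (c , c∈F , y≈) = n , c , v , (λ i → c∈F i , i , ≈-refl) , y≈

  Span⊆LSpan : ∀ {n} (v : Vector Carrier n) → Span F (Range v) ⊆ members (LSpan v)
  Span⊆LSpan v = Span-least (LSpan v) {X = Range v}
    λ (i , y≈) → Subspace.resp (LSpan v) (sym y≈) (∈-LSpan v i)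

  Span-RangeExcept : ∀ {n} (v c : Vector Carrier n) i {y} → (∀ j → c j ∈ F) →
                     y ≈ comb c v → c i ≈ 0# → y ∈ Span F (RangeExcept i v)
  Span-RangeExcept {suc n} v c i c∈F y≈ cᵢ≈0 =
    n , removeAt c i , removeAt v i ,
    (λ j → c∈F (punchIn i j) , punchIn i j , Fin.punchInᵢ≢i i j , ≈-refl) ,
    trans y≈ (trans (sum-remove {i = i} (λ j → c j * v j))
      (trans (+-congʳ (trans (*-congʳ cᵢ≈0) (zeroˡ _))) (+-identityˡ _)))

  -- Linear independence in L / W without the quotient; for W = `𝟘` it unfolds to
  -- `LinearlyIndependent`.
  IndependentMod : ∀ {n} → Subspace → Vector Carrier n → Set ℓ
  IndependentMod W v = ∀ c → (∀ i → c i ∈ F) → comb c v ∈ˢ W → ∀ i → c i ≈ 0#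

  independent-antitone : ∀ {n V W} (v : Vector Carrier n) → V ⊑ W → IndependentMod W v → IndependentMod V v
  independent-antitone v V⊑W ind c c∈F comb∈V = ind c c∈F (V⊑W comb∈V)

  independent-∉ : ∀ {n W} (v : Vector Carrier n) → IndependentMod W v → ∀ i → v i ∉ˢ W
  independent-∉ {W = W} v ind i vᵢ∈W = 1≉0 (trans (sym (unit-diag i))
    (ind (unit i) (unit-closed i) (Subspace.resp W (sym (comb-unit i v)) vᵢ∈W) i))

  independent-tail : ∀ {n W} (v : Vector Carrier (suc n)) → IndependentMod W v → IndependentMod (W ⊹ head v) (tail v)
  independent-tail {W = W} v ind c c∈F (w , z , w∈W , (d , d∈F , z≈) , comb≈) i =
    ind (- d ∷ c) (λ { zero → F.-‿closed d∈F ; (suc j) → c∈F j }) (Subspace.resp W (sym (begin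
      - d * head v + comb c (tail v)      ≈⟨ +-cong
        (trans (sym (-‿distribˡ-* d (head v))) (-‿cong (trans (*-comm d (head v)) (sym z≈))))
        (trans comb≈ (+-comm w z)) ⟩
      - z + (z + w)                       ≈⟨ \\-leftDividesʳ z w ⟩
      w                                   ∎)) w∈W) (suc i)

  independent-∷ : ∀ {n W x} (v : Vector Carrier n) → x ∉ˢ W → IndependentMod (W ⊹ x) v → IndependentMod W (x ∷ v)
  independent-∷ {W = W} {x} v x∉W ind c c∈F comb∈W = λ { zero → c₀≈0 ; (suc i) → tail≈0 i }
    where
    c₀ = head c

    tail≈0 : ∀ i → tail c i ≈ 0#
    tail≈0 = ind (tail c) (c∈F ∘ suc) (+-cancelˡ-∈ (W ⊹ x)
      (Subspace.*-closed (W ⊹ x) (c∈F zero) (x∈W⊹x W x)) (⊑-⊞ˡ W (x ◃ 𝔽) comb∈W))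

    c₀x∈W : c₀ * x ∈ˢ W
    c₀x∈W = Subspace.resp W (trans (+-congˡ (comb-0ˡ (tail c) v tail≈0)) (+-identityʳ _)) comb∈W

    c₀≈0 : c₀ ≈ 0#
    c₀≈0 = decidable-stable em (λ c₀≉0 → x∉W (*-cancelˡ-∈ W (c∈F zero) c₀≉0 c₀x∈W))

  record IsBasisMod {n} (V W : Subspace) (v : Vector Carrier n) : Set ℓ where
    field
      ∈V          : ∀ i → v i ∈ˢ V
      spanning    : V ⊑ W ⊞ LSpan v
      independent : IndependentMod W v

  isBasisMod-∷ : ∀ {n V W x} (v : Vector Carrier n) → x ∈ˢ V → x ∉ˢ W →
                 IsBasisMod V (W ⊹ x) v → IsBasisMod V W (x ∷ v)
  isBasisMod-∷ {W = W} {x} v x∈V x∉W isBasis = record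
    { ∈V          = λ { zero → x∈V ; (suc i) → isBasis.∈V i }
    ; spanning    = ⊞-least (W ⊹ x) (LSpan v) W′
        (⊹-least W W′ (⊑-⊞ˡ W (LSpan (x ∷ v))) (v∈W′ zero))
        (LSpan-least W′ v (v∈W′ ∘ suc))
      ∘ isBasis.spanning
    ; independent = independent-∷ {W = W} v x∉W isBasis.independent
    }
    where
    module isBasis = IsBasisMod isBasis
    W′ = W ⊞ LSpan (x ∷ v)

    v∈W′ : ∀ i → (x ∷ v) i ∈ˢ W′
    v∈W′ i = ⊑-⊞ʳ W (LSpan (x ∷ v)) (∈-LSpan (x ∷ v) i)

  codim⇒basis : ∀ {V W n} → Codim V W n → ∃ λ (v : Vector Carrier n) → IsBasisMod V W v
  codim⇒basis {W = W} (done V⊑W) = [] , record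
    { ∈V          = λ ()
    ; spanning    = ⊑-⊞ˡ W (LSpan []) ∘ V⊑W
    ; independent = λ _ _ _ ()
    }
  codim⇒basis {V} {W} (step x x∈V x∉W c) = let v , isBasis = codim⇒basis c in
    x ∷ v , isBasisMod-∷ v x∈V x∉W isBasis

  independent⇒codim : ∀ {n V W} (v : Vector Carrier n) → (∀ i → v i ∈ˢ V) → V ⊑ W ⊞ LSpan v →
                      IndependentMod W v → Codim V W n
  independent⇒codim {zero} {V} {W} v v∈V V⊑ ind = done (⊞-least W (LSpan v) W id
    (LSpan-least W v (λ ())) ∘ V⊑)
  independent⇒codim {suc n} {V} {W} v v∈V V⊑ ind = step (head v) (v∈V zero) (independent-∉ {W = W} v ind zero)
    (independent⇒codim (tail v) (v∈V ∘ suc)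
      (⊞-least W (LSpan v) W′ (⊑-⊞ˡ (W ⊹ head v) (LSpan (tail v)) ∘ ⊑-⊞ˡ W (head v ◃ 𝔽))
        (LSpan-least W′ v λ
          { zero    → ⊑-⊞ˡ (W ⊹ head v) (LSpan (tail v)) (x∈W⊹x W (head v))
          ; (suc i) → ⊑-⊞ʳ (W ⊹ head v) (LSpan (tail v)) (∈-LSpan (tail v) i)
          })
       ∘ V⊑)
      (independent-tail {W = W} v ind))
    where W′ = (W ⊹ head v) ⊞ LSpan (tail v)

  LSpan-codim : ∀ {n W} (v : Vector Carrier n) → IndependentMod W v → Codim (W ⊞ LSpan v) W n
  LSpan-codim {W = W} v = independent⇒codim v (⊑-⊞ʳ W (LSpan v) ∘ ∈-LSpan v) id

  isBasis⇒dim : ∀ {n} V (v : Vector Carrier n) → IsBasis F (members V) v → Dim V n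
  isBasis⇒dim V v isBasis = independent⇒codim v (IsBasis.members isBasis)
    (⊑-⊞ʳ 𝟘 (LSpan v) ∘ Span⊆LSpan v ∘ IsBasis.spanning isBasis) (IsBasis.independent isBasis)

  hasDim⇒dim : ∀ {n} V → HasDim F (members V) n → Dim V n
  hasDim⇒dim V (v , isBasis) = isBasis⇒dim V v isBasis

  𝟘⊞-least : ∀ V → 𝟘 ⊞ V ⊑ V
  𝟘⊞-least V = ⊞-least 𝟘 V V (λ x≈0 → Subspace.resp V (sym x≈0) (Subspace.0-closed V)) id

  𝟘⊑ : ∀ V → 𝟘 ⊑ V
  𝟘⊑ V x≈0 = Subspace.resp V (sym x≈0) (Subspace.0-closed V)

  dim⇒hasDim : ∀ {n} V → Dim V n → HasDim F (members V) n
  dim⇒hasDim V c = let v , isBasis = codim⇒basis c in v , record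
    { members     = IsBasisMod.∈V isBasis
    ; spanning    = LSpan⊆Span v ∘ 𝟘⊞-least (LSpan v) ∘ IsBasisMod.spanning isBasis
    ; independent = IsBasisMod.independent isBasis
    }

  independent⇒isBasis : ∀ {n V} (v : Vector Carrier n) → Dim V n → (∀ i → v i ∈ˢ V) →
                        IndependentMod 𝟘 v → IsBasis F (members V) v
  independent⇒isBasis {V = V} v dimV v∈V ind = record
    { members     = v∈V
    ; spanning    = LSpan⊆Span v ∘ codim-full {W = 𝟘} dimV
        (independent⇒codim {V = LSpan v} v (∈-LSpan v) (⊑-⊞ʳ 𝟘 (LSpan v)) ind) (LSpan-least V v v∈V) (𝟘⊑ (LSpan v))
    ; independent = ind
    }

  -- The Hall condition survives enlarging each V i, one dimension at a time, to a hyperplane: if it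
  -- failed for two enlargements of V i that meet in V i, the modular law would make it fail for V.
  module Rado (B : Subspace) {n} (dimB : Dim B n) where

    -- B is among the intersected spaces, so that the meet over the empty J is B.
    Meet : ∀ {m} → FS.Subset m → Vector Subspace m → Subspace
    Meet J V = ⟪ (λ x → x ∈ˢ B × (∀ i → i FS.∈ J → x ∈ˢ V i)) , record
      { resp     = λ x≈y (x∈B , x∈V) → Subspace.resp B x≈y x∈B , λ i i∈J → Subspace.resp (V i) x≈y (x∈V i i∈J)
      ; 0-closed = Subspace.0-closed B , λ i _ → Subspace.0-closed (V i)
      ; +-closed = λ (x∈B , x∈V) (y∈B , y∈V) →
          Subspace.+-closed B x∈B y∈B , λ i i∈J → Subspace.+-closed (V i) (x∈V i i∈J) (y∈V i i∈J)
      ; *-closed = λ c∈F (x∈B , x∈V) → Subspace.*-closed B c∈F x∈B , λ i i∈J → Subspace.*-closed (V i) c∈F (x∈V i i∈J)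
      } ⟫

    Meet⊑B : ∀ {m} J (V : Vector Subspace m) → Meet J V ⊑ B
    Meet⊑B J V = proj₁

    dim⊑B : ∀ {V} → V ⊑ B → ∃ (Dim V)
    dim⊑B V⊑B = codim-exists n dimB V⊑B id

    -- Rado's condition read in the dual of B: the annihilators of the B ∩ V i with i in J together
    -- span a space of dimension n - k, which must be at least |J|.
    Hall : ∀ {m} → Vector Subspace m → Set ℓ
    Hall V = ∀ J k → Dim (Meet J V) k → k ℕ.+ FS.∣ J ∣ ≤ n

    Violation : ∀ {m} → Vector Subspace m → Set ℓ
    Violation V = ∃[ J ] ∃[ k ] Dim (Meet J V) k × n < k ℕ.+ FS.∣ J ∣

    hall? : ∀ {m} (V : Vector Subspace m) → Hall V ⊎ Violation V
    hall? V = by-cases em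
      where
      by-cases : Dec (Violation V) → Hall V ⊎ Violation V
      by-cases (yes v) = inj₂ v
      by-cases (no ¬v) = inj₁ λ J k dimM → ℕ.≮⇒≥ λ n< → ¬v (J , k , dimM , n<)

    infixl 5 _[_≔_]

    _[_≔_] : ∀ {m} → Vector Subspace m → Fin m → Subspace → Vector Subspace m
    V [ i ≔ W ] = updateAt V i (const W)

    module _ {m} (V : Vector Subspace m) (i : Fin m) (W : Subspace) where

      ∈-≔⁻ : ∀ {x j} → j ≢ i → x ∈ˢ (V [ i ≔ W ]) j → x ∈ˢ V j
      ∈-≔⁻ {x} {j} j≢i = subst (x ∈ˢ_) (updateAt-minimal j i V j≢i)

      ∈-≔⁻-≡ : ∀ {x} → x ∈ˢ (V [ i ≔ W ]) i → x ∈ˢ W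
      ∈-≔⁻-≡ {x} = subst (x ∈ˢ_) (updateAt-updates i V)

      -- Away from i the two families agree, so a violating J without i would already violate the
      -- condition for V.
      violation-uses-i : Hall V → ∀ J k → Dim (Meet J (V [ i ≔ W ])) k → n < k ℕ.+ FS.∣ J ∣ → i FS.∈ J
      violation-uses-i hall J k dimM n< = decidable-stable (i FS.∈? J) λ i∉J →
        let M⊑ : Meet J (V [ i ≔ W ]) ⊑ Meet J V
            M⊑ = λ (x∈B , x∈V) → x∈B , λ j j∈J → ∈-≔⁻ (λ j≡i → i∉J (subst (FS._∈ J) j≡i j∈J)) (x∈V j j∈J)
            k′ , dimM′ = dim⊑B (Meet⊑B J V)
        in ℕ.<⇒≱ n< (ℕ.≤-trans (ℕ.+-monoˡ-≤ FS.∣ J ∣ (codim-mono dimM′ M⊑ id dimM)) (hall J k′ dimM′))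

    -- Sets I, J that violate the condition for the two enlargements both contain i. So P ∩ Q lies
    -- in X ∩ Y, hence in V i, and thus in the meet over I ∪ J; P + Q lies in the meet over I ∩ J
    -- without i, where both families agree with V. The Hall bounds for these two meets are
    -- incompatible with the violations.
    hall-dichotomy : ∀ {m} (V : Vector Subspace m) i {X Y} → (∀ {z} → z ∈ˢ X → z ∈ˢ Y → z ∈ˢ V i) →
                     Hall V → Hall (V [ i ≔ X ]) ⊎ Hall (V [ i ≔ Y ])
    hall-dichotomy V i {X} {Y} X⊓Y⊑V hall =
      [ inj₁ , (λ vX → [ inj₂ , ⊥-elim ∘ absurd vX ]′ (hall? (V [ i ≔ Y ]))) ]′ (hall? (V [ i ≔ X ]))
      where
      absurd : Violation (V [ i ≔ X ]) → ¬ Violation (V [ i ≔ Y ])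
      absurd (I , p , dimP , n<p) (J , q , dimQ , n<q) = submodularity-contradiction n<p n<q
          (codim-unique (codim-trans dimD codimD (𝟘⊑ D) proj₂) dimQ) (∣p∪q∣+∣p∩q∣≡∣p∣+∣q∣ I J)
          (bound (I FS.∪ J) P⊓Q⊑ dimD) (∣p∣≤1+∣p∖i∣ (I FS.∩ J) i) (bound I∩J∖i S⊑ dimS)
        where
        P = Meet I (V [ i ≔ X ])
        Q = Meet J (V [ i ≔ Y ])
        -- The factor `1#` changes nothing; it brings Q into the form that `codim-⊞` speaks of.
        S = P ⊞ 1# ◃ Q
        i∈I = violation-uses-i V i X hall I p dimP n<p
        i∈J = violation-uses-i V i Y hall J q dimQ n<q

        P⊓Q⊑ : P ⊓ Q ⊑ Meet (I FS.∪ J) V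
        P⊓Q⊑ {z} ((z∈B , z∈VX) , (_ , z∈VY)) = z∈B , λ j j∈ → z∈V j (FS.x∈p∪q⁻ I J j∈) (j Fin.≟ i)
          where
          z∈V : ∀ j → j FS.∈ I ⊎ j FS.∈ J → Dec (j ≡ i) → z ∈ˢ V j
          z∈V j _          (yes refl) = X⊓Y⊑V (∈-≔⁻-≡ V i X (z∈VX i i∈I)) (∈-≔⁻-≡ V i Y (z∈VY i i∈J))
          z∈V j (inj₁ j∈I) (no j≢i)   = ∈-≔⁻ V i X j≢i (z∈VX j j∈I)
          z∈V j (inj₂ j∈J) (no j≢i)   = ∈-≔⁻ V i Y j≢i (z∈VY j j∈J)

        I∩J∖i = (I FS.∩ J) ∖ i

        S⊑ : S ⊑ Meet I∩J∖i V
        S⊑ = ⊞-least P (1# ◃ Q) (Meet I∩J∖i V)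
          (λ (z∈B , z∈VX) → z∈B , λ j j∈ →
            let j∈I∩J , j≢i = ∈-∖⁻ (I FS.∩ J) j∈ in
            ∈-≔⁻ V i X j≢i (z∈VX j (proj₁ (FS.x∈p∩q⁻ I J j∈I∩J))))
          (λ (z , (z∈B , z∈VY) , x≈) → Subspace.resp (Meet I∩J∖i V) (sym (trans x≈ (*-identityˡ z))) (z∈B , λ j j∈ →
            let j∈I∩J , j≢i = ∈-∖⁻ (I FS.∩ J) j∈ in
            ∈-≔⁻ V i Y j≢i (z∈VY j (proj₂ (FS.x∈p∩q⁻ I J j∈I∩J)))))

        D = P ⊓ Q
        d∃ = codim-exists {W = 𝟘} {𝟘} q dimQ (λ {x} → proj₂ {A = x ∈ˢ P}) id
        d = proj₁ d∃
        dimD = proj₂ d∃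
        c∃ = codim-exists {W = 𝟘} {D} q dimQ id (𝟘⊑ D)
        c = proj₁ c∃
        codimD = proj₂ c∃

        dimS : Dim S (p ℕ.+ c)
        dimS = codim-trans dimP
          (codim-resp id id
            (⊞-least P (1# ◃ D) P id (λ (z , (z∈P , _) , x≈) → Subspace.resp P (sym (trans x≈ (*-identityˡ z))) z∈P))
            (⊑-⊞ˡ P (1# ◃ D))
            (codim-⊞ {P} {Q} {D} 1# proj₂ (λ {z} z∈Q 1z∈P → Subspace.resp P (*-identityˡ z) 1z∈P , z∈Q) codimD))
          (𝟘⊑ P) (⊑-⊞ˡ P (1# ◃ Q))

        bound : ∀ J {U k} → U ⊑ Meet J V → Dim U k → k ℕ.+ FS.∣ J ∣ ≤ n
        bound J U⊑ dimU = let k′ , dimM = dim⊑B (Meet⊑B J V) in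
          ℕ.≤-trans (ℕ.+-monoˡ-≤ FS.∣ J ∣ (codim-mono dimM U⊑ id dimU)) (hall J k′ dimM)

    Hyperplane : Subspace → Set ℓ
    Hyperplane H = H ⊑ B × Codim B H 1

    -- Otherwise the one-element set of i would give n + 1 ≤ n.
    hall⇒proper : ∀ {m} (V : Vector Subspace m) → Hall V → ∀ i → ¬ (B ⊑ V i)
    hall⇒proper V hall i B⊑V = ℕ.<⇒≱ (ℕ.m<m+n n (ℕ.s≤s z≤n))
      (subst (λ k → n ℕ.+ k ≤ n) (FS.∣⁅x⁆∣≡1 i) (hall FS.⁅ i ⁆ n (codim-resp
        (λ x∈B → x∈B , λ j j∈ → subst (λ j → _ ∈ˢ V j) (≡-sym (FS.x∈⁅y⁆⇒x≡y i j∈)) (B⊑V x∈B)) proj₁ id id dimB)))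

    -- Above codimension 1 there are two vectors x, y of B independent modulo V i. The enlargements
    -- by x and by y meet in V i, so one of them keeps the Hall condition.
    enlarge-at : ∀ {m} (V : Vector Subspace m) i k → Hall V → V i ⊑ B → Codim B (V i) (suc k) →
                 ∃[ V′ ] Hall V′ × Hyperplane (V′ i) × V i ⊑ V′ i × (∀ j → j ≢ i → V′ j ≡ V j)
    enlarge-at V i zero    hall Vi⊑B c = V , hall , (Vi⊑B , c) , id , λ _ _ → refl
    enlarge-at V i (suc k) hall Vi⊑B (step x x∈B x∉V c@(step y y∈B y∉ _)) =
      [ via x x∈B x∉V , via y y∈B (y∉ ∘ ⊑-⊞ˡ (V i) (x ◃ 𝔽)) ]′ (hall-dichotomy V i X⊓Y⊑V hall)
      where
      X⊓Y⊑V : ∀ {z} → z ∈ˢ V i ⊹ x → z ∈ˢ V i ⊹ y → z ∈ˢ V i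
      X⊓Y⊑V {z} z∈X z∈Y = decidable-stable em λ z∉V →
        y∉ (⊹-least (V i) (V i ⊹ x) (⊑-⊞ˡ (V i) (x ◃ 𝔽)) z∈X (⊹-exchange (V i) z∈Y z∉V))

      via : ∀ z → z ∈ˢ B → z ∉ˢ V i → Hall (V [ i ≔ V i ⊹ z ]) →
            ∃[ V′ ] Hall V′ × Hyperplane (V′ i) × V i ⊑ V′ i × (∀ j → j ≢ i → V′ j ≡ V j)
      via z z∈B z∉V hall₁ =
        let V₁ = V [ i ≔ V i ⊹ z ]
            V₁i≡ = ≡-sym (updateAt-updates i {const (V i ⊹ z)} V)
            V′ , hall′ , hyp , ⊑V′ , V′≡ = enlarge-at V₁ i k hall₁
              (subst (λ U → U ⊑ B) V₁i≡ (⊹-least (V i) B Vi⊑B z∈B))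
              (subst (λ U → Codim B U (suc k)) V₁i≡ (codim-exchange {W = V i} z∈B z∉V (step x x∈B x∉V c)))
        in V′ , hall′ , hyp , ⊑V′ ∘ subst (λ U → V i ⊑ U) V₁i≡ (⊑-⊞ˡ (V i) (z ◃ 𝔽)) ,
           λ j j≢i → ≡-trans (V′≡ j j≢i) (updateAt-minimal j i V j≢i)

    enlarge : ∀ {m} (V : Vector Subspace m) → Hall V → (∀ i → V i ⊑ B) → (is : List (Fin m)) →
              ∃[ V′ ] Hall V′ × (∀ j → V j ⊑ V′ j × V′ j ⊑ B) × (∀ j → j List.∈ is → Hyperplane (V′ j))
    enlarge V hall V⊑B List.[] = V , hall , (λ j → id , V⊑B j) , λ _ ()
    enlarge V hall V⊑B (i List.∷ is) =
      let V₁ , hall₁ , V⊑V₁⊑B , hyp₁ = enlarge V hall V⊑B is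
          k , c = codim-exists n dimB id (𝟘⊑ (V₁ i))
      in extend V₁ hall₁ V⊑V₁⊑B hyp₁ k c
      where
      extend : ∀ V₁ → Hall V₁ → (∀ j → V j ⊑ V₁ j × V₁ j ⊑ B) → (∀ j → j List.∈ is → Hyperplane (V₁ j)) →
               ∀ k → Codim B (V₁ i) k →
               ∃[ V′ ] Hall V′ × (∀ j → V j ⊑ V′ j × V′ j ⊑ B) × (∀ j → j List.∈ i List.∷ is → Hyperplane (V′ j))
      extend V₁ hall₁ V⊑V₁⊑B hyp₁ zero    (done B⊑) = ⊥-elim (hall⇒proper V₁ hall₁ i B⊑)
      extend V₁ hall₁ V⊑V₁⊑B hyp₁ (suc k) c         =
        let V′ , hall′ , hyp′ , V₁i⊑ , V′≡ = enlarge-at V₁ i k hall₁ (proj₂ (V⊑V₁⊑B i)) c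
        in V′ , hall′ , (λ j → between V′ hyp′ V₁i⊑ V′≡ j (j Fin.≟ i)) , hyp V′ hyp′ V′≡
        where
        between : ∀ V′ → Hyperplane (V′ i) → V₁ i ⊑ V′ i → (∀ j → j ≢ i → V′ j ≡ V₁ j) →
                  ∀ j → Dec (j ≡ i) → V j ⊑ V′ j × V′ j ⊑ B
        between V′ hyp′ V₁i⊑ V′≡ j (yes refl) = V₁i⊑ ∘ proj₁ (V⊑V₁⊑B j) , proj₁ hyp′
        between V′ hyp′ V₁i⊑ V′≡ j (no j≢i) = subst (λ U → V j ⊑ U × U ⊑ B) (≡-sym (V′≡ j j≢i)) (V⊑V₁⊑B j)

        hyp : ∀ V′ → Hyperplane (V′ i) → (∀ j → j ≢ i → V′ j ≡ V₁ j) → ∀ j → j List.∈ i List.∷ is → Hyperplane (V′ j)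
        hyp V′ hyp′ V′≡ j (here refl) = hyp′
        hyp V′ hyp′ V′≡ j (there j∈) = by-cases (j Fin.≟ i)
          where
          by-cases : Dec (j ≡ i) → Hyperplane (V′ j)
          by-cases (yes refl) = hyp′
          by-cases (no j≢i)   = subst Hyperplane (≡-sym (V′≡ j j≢i)) (hyp₁ j j∈)

    -- Putting i back into J ∖ i lowers the meet by at most one dimension, because M′ / M embeds
    -- into B / V i. The bound c carries the induction.
    codim-Meet : ∀ {m} (V : Vector Subspace m) → (∀ i → Hyperplane (V i)) →
                 ∀ c J k → FS.∣ J ∣ ≤ c → Codim B (Meet J V) k → k ≤ c
    codim-Meet V hyp c J k ∣J∣≤c codimM = by-cases c ∣J∣≤c (FS.nonempty? J)
      where
      M = Meet J V

      by-cases : ∀ c → FS.∣ J ∣ ≤ c → Dec (FS.Nonempty J) → k ≤ c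
      by-cases c _ (no empty) = subst (_≤ c) (≡-sym (codim-0
        (λ x∈B → x∈B , λ i i∈J → contradiction (i , i∈J) empty) codimM)) z≤n
      by-cases zero ∣J∣≤0 (yes (i , i∈J)) = contradiction (ℕ.<-≤-trans (∣p∖i∣<∣p∣ i∈J) ∣J∣≤0) λ ()
      by-cases (suc c) ∣J∣≤1+c (yes (i , i∈J)) =
        let k′ , codimM′ = codim-exists n dimB id (𝟘⊑ M′)
            l , codimMM′ = codim-exists {W = 𝟘} n dimB (Meet⊑B (J ∖ i) V) (𝟘⊑ M)
            l≤1 = codim-mono (proj₂ (hyp i))
              (⊞-least (V i) (1# ◃ M′) B (proj₁ (hyp i))
                (λ (z , (z∈B , _) , x≈) → Subspace.resp B (sym (trans x≈ (*-identityˡ z))) z∈B))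
              (⊑-⊞ˡ (V i) (1# ◃ M))
              (codim-⊞ {V i} {M′} {M} 1# M⊑M′ M′⊓V⊑M codimMM′)
        in ℕ.≤-trans (ℕ.≤-reflexive (codim-unique codimM (codim-trans codimMM′ codimM′ M⊑M′ (Meet⊑B (J ∖ i) V))))
             (ℕ.+-mono-≤ l≤1 (codim-Meet V hyp c (J ∖ i) k′ (ℕ.s≤s⁻¹ (ℕ.<-≤-trans (∣p∖i∣<∣p∣ i∈J) ∣J∣≤1+c)) codimM′))
        where
        M′ = Meet (J ∖ i) V

        M⊑M′ : M ⊑ M′
        M⊑M′ (x∈B , x∈V) = x∈B , λ j j∈ → x∈V j (proj₁ (∈-∖⁻ J j∈))

        M′⊓V⊑M : ∀ {z} → z ∈ˢ M′ → 1# * z ∈ˢ V i → z ∈ˢ M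
        M′⊓V⊑M {z} (z∈B , z∈V) 1z∈V = z∈B , λ j j∈J → in-V j j∈J (j Fin.≟ i)
          where
          in-V : ∀ j → j FS.∈ J → Dec (j ≡ i) → z ∈ˢ V j
          in-V j j∈J (yes refl) = Subspace.resp (V i) (*-identityˡ z) 1z∈V
          in-V j j∈J (no j≢i)   = z∈V j (∈-∖⁺ j∈J j≢i)

    -- b i spans the intersection of all the hyperplanes but the i-th.
    hyperplanes⇒basis : (V : Vector Subspace n) → Hall V → (∀ i → Hyperplane (V i)) →
                        ∃ λ (b : Vector Carrier n) → IsBasis F (members B) b ×
                          (∀ i → members (V i) ⊆ Span F (RangeExcept i b))
    hyperplanes⇒basis V hall hyp = b , isBasis , V⊆Span
      where
      -- The Hall condition for the set of all indices reads k + n ≤ n.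
      Meet⊤⊑𝟘 : Meet FS.⊤ V ⊑ 𝟘
      Meet⊤⊑𝟘 = let k , dimM = dim⊑B (Meet⊑B FS.⊤ V) in
        dim0 k dimM (ℕ.n≤0⇒n≡0 (ℕ.+-cancelʳ-≤ n k 0 (subst (λ t → k ℕ.+ t ≤ n) (FS.∣⊤∣≡n n) (hall FS.⊤ k dimM))))
        where
        dim0 : ∀ {V} k → Dim V k → k ≡ 0 → V ⊑ 𝟘
        dim0 _ (done V⊑𝟘) _ = V⊑𝟘

      -- The other n - 1 hyperplanes meet in codimension at most n - 1, whereas 0 has codimension n
      -- in B.
      line∃ : ∀ i → ∃[ x ] x ∈ˢ Meet (FS.⊤ ∖ i) V × x ∉ˢ 𝟘
      line∃ i = decidable-stable em λ none →
        let N = Meet (FS.⊤ ∖ i) V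
            N⊑𝟘 = λ {x} x∈N → decidable-stable em (λ x≉0 → none (x , x∈N , x≉0))
            codimN = codim-resp id id (𝟘⊑ N) (λ {x} → N⊑𝟘 {x}) dimB
        in ℕ.<⇒≱ (subst (FS.∣ FS.⊤ ∖ i ∣ <_) (FS.∣⊤∣≡n n) (∣p∖i∣<∣p∣ (FS.∈⊤ {x = i})))
             (codim-Meet V hyp FS.∣ FS.⊤ ∖ i ∣ (FS.⊤ ∖ i) n ℕ.≤-refl codimN)

      b : Vector Carrier n
      b i = proj₁ (line∃ i)

      b∈V : ∀ i j → j ≢ i → b i ∈ˢ V j
      b∈V i j j≢i = proj₂ (proj₁ (proj₂ (line∃ i))) j (∈-∖⁺ FS.∈⊤ j≢i)

      b∈B : ∀ i → b i ∈ˢ B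
      b∈B i = proj₁ (proj₁ (proj₂ (line∃ i)))

      b∉V : ∀ i → b i ∉ˢ V i
      b∉V i bᵢ∈V = proj₂ (proj₂ (line∃ i)) (Meet⊤⊑𝟘 (b∈B i , λ j _ → in-V j (j Fin.≟ i)))
        where
        in-V : ∀ j → Dec (j ≡ i) → b i ∈ˢ V j
        in-V j (yes refl) = bᵢ∈V
        in-V j (no j≢i)   = b∈V i j j≢i

      -- All b j with j ≠ i lie in V i, so a combination in V i leaves `c i * b i` there. Applied to
      -- the combination 0 this gives independence, and applied to y in V i the inclusion of V i in
      -- the span of the others.
      coefficient≈0 : ∀ c → (∀ j → c j ∈ F) → ∀ i → comb c b ∈ˢ V i → c i ≈ 0#
      coefficient≈0 c c∈F i comb∈V = decidable-stable em λ cᵢ≉0 →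
        b∉V i (*-cancelˡ-∈ (V i) (c∈F i) cᵢ≉0 (term-closed (V i) (λ j → c j * b j) i
          (λ j j≢i → Subspace.*-closed (V i) (c∈F j) (b∈V j i (j≢i ∘ ≡-sym))) comb∈V))

      isBasis : IsBasis F (members B) b
      isBasis = independent⇒isBasis b dimB b∈B
        λ c c∈F comb≈0 i → coefficient≈0 c c∈F i (𝟘⊑ (V i) comb≈0)

      V⊆Span : ∀ i → members (V i) ⊆ Span F (RangeExcept i b)
      V⊆Span i {y} y∈V =
        let c , c∈F , y≈ = Span⊆LSpan b (IsBasis.spanning isBasis (proj₁ (hyp i) y∈V))
        in Span-RangeExcept b c i c∈F y≈ (coefficient≈0 c c∈F i (Subspace.resp (V i) y≈ y∈V))

    rado : (V : Vector Subspace n) → (∀ i → V i ⊑ B) → Hall V →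
           ∃ λ (b : Vector Carrier n) → IsBasis F (members B) b × (∀ i → members (V i) ⊆ Span F (RangeExcept i b))
    rado V V⊑B hall =
      let V′ , hall′ , V⊑V′⊑B , hyp = enlarge V hall V⊑B (allFin n)
          b , isBasis , V′⊆Span = hyperplanes⇒basis V′ hall′ (λ i → hyp i (∈-allFin i))
      in b , isBasis , λ i y∈V → V′⊆Span i (proj₁ (V⊑V′⊑B i) y∈V)

  -- Coordinates, stabilizers and direct sums

  comb-injective : ∀ {n} (c d v : Vector Carrier n) → IndependentMod 𝟘 v → (∀ i → c i ∈ F) → (∀ i → d i ∈ F) →
                   comb c v ≈ comb d v → ∀ i → c i ≈ d i
  comb-injective c d v ind c∈F d∈F c≈d i =
    x∙y⁻¹≈ε⇒x≈y (c i) (d i) (trans (+-congˡ (sym (-1*x≈-x (d i)))) (c-d≈0 i))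
    where
    c-d≈0 : ∀ i → c i + - 1# * d i ≈ 0#
    c-d≈0 = ind (λ i → c i + - 1# * d i) (λ i → F.+-closed (c∈F i) (F.*-closed (F.-‿closed F.1-closed) (d∈F i))) (begin
      comb (λ i → c i + - 1# * d i) v      ≈⟨ comb-+ c (λ i → - 1# * d i) v ⟩
      comb c v + comb (λ i → - 1# * d i) v ≈⟨ +-cong c≈d (trans (comb-* (- 1#) d v) (-1*x≈-x _)) ⟩
      comb d v + - comb d v                ≈⟨ -‿inverseʳ _ ⟩
      0#                                   ∎)

  dim-◃ : ∀ {Q n e} → ¬ (e ≈ 0#) → Dim Q n → Dim (e ◃ Q) n
  dim-◃ {Q} {n} {e} e≉0 dimQ = codim-resp
    (𝟘⊞-least (e ◃ Q)) (⊑-⊞ʳ 𝟘 (e ◃ Q))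
    (⊞-least 𝟘 (e ◃ 𝟘) 𝟘 id (λ (z , z≈0 , x≈) → trans x≈ (trans (*-congˡ z≈0) (zeroʳ e)))) (⊑-⊞ˡ 𝟘 (e ◃ 𝟘))
    (codim-⊞ {𝟘} e (𝟘⊑ Q) (λ _ → x≉0∧x*y≈0⇒y≈0 e≉0) dimQ)

  Stabilizer : Subspace → Subset
  Stabilizer S t = ∀ x → x ∈ˢ S → t * x ∈ˢ S

  stabilizer-isSubfield : ∀ {n} S → Dim S n → IsSubfield (Stabilizer S)
  stabilizer-isSubfield S dimS = record
    { resp      = λ s≈t s-stab x x∈S → S.resp (*-congʳ s≈t) (s-stab x x∈S)
    ; 0-closed  = λ x _ → S.resp (sym (zeroˡ x)) S.0-closed
    ; 1-closed  = λ x x∈S → S.resp (sym (*-identityˡ x)) x∈S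
    ; +-closed  = λ s-stab t-stab x x∈S → S.resp (sym (distribʳ x _ _)) (S.+-closed (s-stab x x∈S) (t-stab x x∈S))
    ; *-closed  = λ s-stab t-stab x x∈S → S.resp (sym (*-assoc _ _ x)) (s-stab _ (t-stab x x∈S))
    ; -‿closed  = λ t-stab x x∈S → S.resp (-‿distribˡ-* _ x) (neg-closed S (t-stab x x∈S))
    -- Here sS = S by equality of dimensions; with x = s z, the product t x is z.
    ; ⁻¹-closed = λ {s} {t} s-stab st≈1 x x∈S →
        let z , z∈S , x≈ = S⊑sS s-stab st≈1 x∈S
        in S.resp (sym (trans (*-congˡ x≈) (x-factor z st≈1))) z∈S
    }
    where
    module S = Subspace S

    S⊑sS : ∀ {s t} → Stabilizer S s → s * t ≈ 1# → S ⊑ s ◃ S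
    S⊑sS {s} {t} s-stab st≈1 = codim-full {W = 𝟘} dimS
      (dim-◃ {S} (inverse≉0 (trans (*-comm t s) st≈1)) dimS)
      (λ (z , z∈S , x≈) → S.resp (sym x≈) (s-stab z z∈S)) (𝟘⊑ (s ◃ S))

  Stabilizer-F : ∀ S → F ⊆ Stabilizer S
  Stabilizer-F S c∈F x x∈S = Subspace.*-closed S c∈F x∈S

  -- Minimality is all that is asked of the span: it is applied with T = A and, for fixed u, with T
  -- = `A ∶ u`. The recursion follows J so that the chain has length |J|.
  subset-span : ∀ {n} W (v : Vector Carrier n) → IndependentMod W v → (J : FS.Subset n) →
                ∃[ X ] Codim X W FS.∣ J ∣ × W ⊑ X × (∀ T → W ⊑ T → (∀ i → i FS.∈ J → v i ∈ˢ T) → X ⊑ T)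
  subset-span W v ind Vec.[] = W , done id , id , λ T W⊑T _ → W⊑T
  subset-span W v ind (false Vec.∷ J) =
    let X , codimX , W⊑X , least = subset-span W (tail v)
          (independent-antitone {V = W} {W ⊹ head v} (tail v) (⊑-⊞ˡ W (head v ◃ 𝔽)) (independent-tail {W = W} v ind)) J
    in X , codimX , W⊑X , λ T W⊑T v∈T → least T W⊑T (λ i i∈J → v∈T (suc i) (Vec.there i∈J))
  subset-span W v ind (true Vec.∷ J) =
    let X , codimX , W⊹⊑X , least = subset-span (W ⊹ head v) (tail v) (independent-tail {W = W} v ind) J
    in X , step (head v) (W⊹⊑X (x∈W⊹x W (head v))) (independent-∉ {W = W} v ind zero) codimX ,
       W⊹⊑X ∘ ⊑-⊞ˡ W (head v ◃ 𝔽) ,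
       λ T W⊑T v∈T → least T (⊹-least W T W⊑T (v∈T zero Vec.here)) (λ i i∈J → v∈T (suc i) (Vec.there i∈J))

  directSum⁺ : ∀ U V Y → U ⊑ V ⊞ Y → V ⊞ Y ⊑ U → (∀ {x} → x ∈ˢ V → x ∈ˢ Y → x ≈ 0#) →
               IsDirectSum (members U) (members V ∷ members Y ∷ [])
  directSum⁺ U V Y U⊑ ⊑U disjoint =
    (λ y → mk⇔
      (λ y∈U → let v , w , v∈V , w∈Y , y≈ = U⊑ y∈U in
        (v ∷ w ∷ []) , (λ { zero → v∈V ; (suc zero) → w∈Y }) , trans y≈ (+-congˡ (sym (+-identityʳ w))))
      (λ (w , w∈ , y≈) → ⊑U (w zero , w (suc zero) , w∈ zero , w∈ (suc zero) , trans y≈ (+-congˡ (+-identityʳ _))))) ,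
    unique
    where
    unique : (w w′ : Vector Carrier 2) →
             (∀ i → w i ∈ (members V ∷ members Y ∷ []) i) → (∀ i → w′ i ∈ (members V ∷ members Y ∷ []) i) →
             sum w ≈ sum w′ → ∀ i → w i ≈ w′ i
    unique w w′ w∈ w′∈ eq = λ
      { zero       → x∙y⁻¹≈ε⇒x≈y v v′ (trans (+-comm v (- v′)) z≈0)
      ; (suc zero) → trans (sym (trans (+-congʳ z≈0) (+-identityˡ y))) z+y≈y′
      }
      where
      v = w zero
      v′ = w′ zero
      y = w (suc zero)
      y′ = w′ (suc zero)

      z+y≈y′ : (- v′ + v) + y ≈ y′
      z+y≈y′ = begin
        (- v′ + v) + y         ≈⟨ +-assoc (- v′) v y ⟩
        - v′ + (v + y)         ≈⟨ +-congˡ (+-congˡ (sym (+-identityʳ y))) ⟩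
        - v′ + (v + (y + 0#))  ≈⟨ +-congˡ eq ⟩
        - v′ + (v′ + (y′ + 0#)) ≈⟨ \\-leftDividesʳ v′ (y′ + 0#) ⟩
        y′ + 0#                ≈⟨ +-identityʳ y′ ⟩
        y′                     ∎

      -- The difference z of the V-parts lies in V, and it lies in Y because z + y = y′.
      z≈0 : - v′ + v ≈ 0#
      z≈0 = disjoint (Subspace.+-closed V (neg-closed V (w′∈ zero)) (w∈ zero))
        (+-cancelˡ-∈ Y (w∈ (suc zero)) (Subspace.resp Y (trans (sym z+y≈y′) (+-comm _ y)) (w′∈ (suc zero))))

  directSum⁻ : ∀ U V Y → IsDirectSum (members U) (members V ∷ members Y ∷ []) →
               U ⊑ V ⊞ Y × V ⊞ Y ⊑ U × (∀ {x} → x ∈ˢ V → x ∈ˢ Y → x ≈ 0#)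
  directSum⁻ U V Y (decompose , unique) =
    (λ {y} y∈U → let w , w∈ , y≈ = Equivalence.to (decompose y) y∈U in
      w zero , w (suc zero) , w∈ zero , w∈ (suc zero) , trans y≈ (+-congˡ (+-identityʳ _))) ,
    (λ {y} (v , w , v∈V , w∈Y , y≈) → Equivalence.from (decompose y)
      ((v ∷ w ∷ []) , (λ { zero → v∈V ; (suc zero) → w∈Y }) , trans y≈ (+-congˡ (sym (+-identityʳ w))))) ,
    λ {x} x∈V x∈Y → unique (x ∷ 0# ∷ []) (0# ∷ x ∷ [])
      (λ { zero → x∈V ; (suc zero) → Subspace.0-closed Y })
      (λ { zero → Subspace.0-closed V ; (suc zero) → x∈Y })
      (trans (+-comm x (0# + 0#)) (trans (+-assoc 0# 0# x) (+-congˡ (+-comm 0# x)))) zero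

  directSum-codim : ∀ {n} U V Y → IsDirectSum (members U) (members V ∷ members Y ∷ []) → Dim Y n → Codim U V n
  directSum-codim U V Y isSum dimY = let U⊑ , ⊑U , disjoint = directSum⁻ U V Y isSum in
    codim-resp
      (⊑U ∘ ⊞-least V (1# ◃ Y) (V ⊞ Y) (⊑-⊞ˡ V Y)
        (λ (z , z∈Y , x≈) → Subspace.resp (V ⊞ Y) (sym (trans x≈ (*-identityˡ z))) (⊑-⊞ʳ V Y z∈Y)))
      (⊞-least V Y (V ⊞ 1# ◃ Y) (⊑-⊞ˡ V (1# ◃ Y)) (λ {z} z∈Y → ⊑-⊞ʳ V (1# ◃ Y) (z , z∈Y , sym (*-identityˡ z))) ∘ U⊑)
      (⊞-least V (1# ◃ 𝟘) V id (λ (z , z≈0 , x≈) → 𝟘⊑ V (trans x≈ (trans (*-identityˡ z) z≈0))))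
      (⊑-⊞ˡ V (1# ◃ 𝟘))
      (codim-⊞ {V} 1# (𝟘⊑ Y) (λ {z} z∈Y 1z∈V → disjoint (Subspace.resp V (*-identityˡ z) 1z∈V) z∈Y) dimY)

  -- A basis of U modulo V spans a complement; independence modulo V makes the intersection trivial.
  complement : ∀ {n p} U V → V ⊑ U → Dim U n → Dim V p →
               ∃[ Y ] ∃[ t ] Dim Y t × p ℕ.+ t ≡ n × IsDirectSum (members U) (members V ∷ members Y ∷ [])
  complement {n} U V V⊑U dimU dimV =
    let t , codimV = codim-exists {W = 𝟘} n dimU id (𝟘⊑ V)
        v , isBasis = codim⇒basis codimV
        module isBasis = IsBasisMod isBasis
    in LSpan v , t ,
       independent⇒codim {W = 𝟘} v (∈-LSpan v) (⊑-⊞ʳ 𝟘 (LSpan v))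
         (independent-antitone {V = 𝟘} {V} v (𝟘⊑ V) isBasis.independent) ,
       codim-unique (codim-trans dimV codimV (𝟘⊑ V) V⊑U) dimU ,
       directSum⁺ U V (LSpan v) isBasis.spanning (⊞-least V (LSpan v) U V⊑U (LSpan-least U v isBasis.∈V))
         λ x∈V (c , c∈F , x≈) → trans x≈ (comb-0ˡ c v (isBasis.independent c c∈F (Subspace.resp V x≈ x∈V)))

  basis⇒directSum : ∀ {n} V (v : Vector Carrier n) → IsBasis F (members V) v →
                    IsDirectSum (members V) (λ i → v i · F)
  basis⇒directSum V v isBasis =
    (λ y → mk⇔
      (λ y∈V → let c , c∈F , y≈ = Span⊆LSpan v (IsBasis.spanning isBasis y∈V) in
        (λ i → v i * c i) , (λ i → c i , c∈F i , ≈-refl) , trans y≈ (sum-cong-≋ (λ i → *-comm (c i) (v i))))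
      (λ (w , w∈ , y≈) → Subspace.resp V (sym y≈) (sum-closed V w
        (λ i → ◃𝔽-least V (IsBasis.members isBasis i) (w∈ i))))) ,
    λ w w′ w∈ w′∈ eq i →
      let c , c∈F , w≈ = coefficients w w∈
          d , d∈F , w′≈ = coefficients w′ w′∈
      in trans (w≈ i) (trans (*-congʳ (comb-injective c d v (IsBasis.independent isBasis) c∈F d∈F
           (trans (sym (sum-cong-≋ w≈)) (trans eq (sum-cong-≋ w′≈))) i)) (sym (w′≈ i)))
    where
    coefficients : ∀ w → (∀ i → w i ∈ v i · F) →
                   ∃ λ (c : Vector Carrier _) → (∀ i → c i ∈ F) × (∀ i → w i ≈ c i * v i)
    coefficients w w∈ = (λ i → proj₁ (w∈ i)) , (λ i → proj₁ (proj₂ (w∈ i))) ,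
      λ i → trans (proj₂ (proj₂ (w∈ i))) (*-comm (v i) (proj₁ (w∈ i)))

  -- An obstruction only says that S is a K-subspace; that K(R), and with it R, maps S to itself is
  -- recovered from the decomposition.
  directSum-*-closed : ∀ {m} {S : Subset} (a : Vector Carrier m) → IsDirectSum S (λ i → a i · F) →
                       ∀ {c x} → c ∈ F → x ∈ S → c * x ∈ S
  directSum-*-closed a (decompose , _) {c} {x} c∈F x∈S =
    let w , w∈ , x≈ = Equivalence.to (decompose x) x∈S in
    Equivalence.from (decompose (c * x))
      ( (λ i → c * w i)
      , (λ i → Subspace.*-closed (a i ◃ 𝔽) c∈F (w∈ i))
      , trans (*-congˡ x≈) (*-distribˡ-sum c w))

  -- From a failed matching to a stable pair

  StablePair : ℕ → Subspace → Subspace → Set (lsuc ℓ)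
  StablePair n A B = ∃[ X ] ∃[ U ] ∃[ p ] ∃[ q ]
    X ⊑ A × U ⊑ B × Dim X p × Dim U q × (∀ x u → x ∈ˢ X → u ∈ˢ U → x * u ∈ˢ X) × n < p ℕ.+ q

  -- Dyson's transform: while eU ⊄ X for some e ∈ X, replace X by X + eU and U by { u ∈ U : eu ∈ X }.
  -- This keeps dim X + dim U and X U ⊆ A, and it lowers dim U.
  dyson : ∀ {n A B} c X U {p q} → q ≤ c → X ⊑ A → U ⊑ B → Dim X p → Dim U q →
          (∀ x u → x ∈ˢ X → u ∈ˢ U → x * u ∈ˢ A) → n < p ℕ.+ q → StablePair n A B
  dyson {n} {A} {B} c X U {p} {q} q≤c X⊑A U⊑B dimX dimU XU⊆A n<p+q = by-cases c q≤c em
    where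
    by-cases : ∀ c → q ≤ c → Dec (∃[ e ] ∃[ u ] e ∈ˢ X × u ∈ˢ U × e * u ∉ˢ X) → StablePair n A B
    by-cases _ _ (no none) = X , U , p , q , X⊑A , U⊑B , dimX , dimU ,
      (λ x u x∈X u∈U → decidable-stable em (λ xu∉X → none (x , u , x∈X , u∈U , xu∉X))) , n<p+q
    by-cases c q≤c (yes (e , u₀ , e∈X , u₀∈U , eu₀∉X)) = recurse c q≤c
      where
      X′ = X ⊞ e ◃ U
      U′ = U ⊓ (X ∶ e)
      k∃ = codim-exists {W = 𝟘} {U′} q dimU id (𝟘⊑ U′)
      q′∃ = codim-exists {V′ = U′} {𝟘} {𝟘} q dimU proj₁ id
      k = proj₁ k∃
      q′ = proj₁ q′∃

      q′+k≡q : q′ ℕ.+ k ≡ q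
      q′+k≡q = codim-unique (codim-trans (proj₂ q′∃) (proj₂ k∃) (𝟘⊑ U′) proj₁) dimU

      0<k : 0 < k
      0<k = positive (proj₂ k∃)
        where
        positive : ∀ {k} → Codim U U′ k → 0 < k
        positive (done U⊑U′)      = contradiction (proj₂ (U⊑U′ u₀∈U)) eu₀∉X
        positive (step _ _ _ _) = s≤s z≤n

      q′<q : q′ < q
      q′<q = subst (q′ <_) q′+k≡q (ℕ.m<m+n q′ 0<k)

      -- For u in U, eu ∈ X means u ∈ U′, so (X + eU) / X ≅ U / U′: X gains the k dimensions that U
      -- loses.
      dimX′ : Dim X′ (p ℕ.+ k)
      dimX′ = codim-trans dimX
        (codim-resp id id
          (⊞-least X (e ◃ U′) X id (λ (u , (_ , eu∈X) , x≈) → Subspace.resp X (sym x≈) eu∈X))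
          (⊑-⊞ˡ X (e ◃ U′))
          (codim-⊞ {X} {U} {U′} e proj₁ _,_ (proj₂ k∃)))
        (𝟘⊑ X) (⊑-⊞ˡ X (e ◃ U))

      X′⊑A : X′ ⊑ A
      X′⊑A = ⊞-least X (e ◃ U) A X⊑A (λ (u , u∈U , x≈) → Subspace.resp A (sym x≈) (XU⊆A e u e∈X u∈U))

      -- By commutativity e passes from v to u: (x₀ + ev)u = x₀u + (eu)v, and eu ∈ X by the choice
      -- of U′.
      X′U′⊆A : ∀ x u → x ∈ˢ X′ → u ∈ˢ U′ → x * u ∈ˢ A
      X′U′⊆A x u (x₀ , z , x₀∈X , (v , v∈U , z≈) , x≈) (u∈U , eu∈X) =
        Subspace.resp A (sym (begin
          x * u                   ≈⟨ *-congʳ (trans x≈ (+-congˡ z≈)) ⟩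
          (x₀ + e * v) * u        ≈⟨ solve 4 (λ x₀ e v u →
            (x₀ :+ e :* v) :* u := x₀ :* u :+ (e :* u) :* v) ≈-refl x₀ e v u ⟩
          x₀ * u + (e * u) * v    ∎))
        (Subspace.+-closed A (XU⊆A x₀ u x₀∈X u∈U) (XU⊆A (e * u) v eu∈X v∈U))

      n<p′+q′ : n < (p ℕ.+ k) ℕ.+ q′
      n<p′+q′ = subst (n <_) (≡-trans (≡-cong (p ℕ.+_) (≡-trans (≡-sym q′+k≡q) (ℕ.+-comm q′ k)))
        (≡-sym (ℕ.+-assoc p k q′))) n<p+q

      recurse : ∀ c → q ≤ c → StablePair n A B
      recurse zero    q≤0   = contradiction (ℕ.<-≤-trans q′<q q≤0) λ ()
      recurse (suc c) q≤1+c = dyson {A = A} {B} c X′ U′ (ℕ.s≤s⁻¹ (ℕ.<-≤-trans q′<q q≤1+c))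
        X′⊑A (U⊑B ∘ proj₁) dimX′ (proj₂ q′∃) X′U′⊆A n<p′+q′

  unmatched⇒stablePair : ∀ {n} A B → Dim B n → (a : Vector Carrier n) → IsBasis F (members A) a →
    ¬ (∃ λ (b : Vector Carrier n) → IsBasis F (members B) b × BasisMatched F (members A) (members B) a b) →
    StablePair n A B
  unmatched⇒stablePair {n} A B dimB a isBasis unmatched =
    [ ⊥-elim ∘ matched , fromViolation ]′ (hall? V)
    where
    open Rado B dimB

    V : Vector Subspace n
    V i = B ⊓ (A ∶ a i)

    matched : ¬ Hall V
    matched hall = let b , b-isBasis , V⊆Span = rado V (λ i → proj₁) hall in
      unmatched (b , b-isBasis , λ i ((a⁻¹ , aa⁻¹≈1 , x , x∈A , y≈) , y∈B) →
        V⊆Span i (y∈B , Subspace.resp A (sym (trans (*-congˡ y≈)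
          (x-factor x (trans (*-comm a⁻¹ (a i)) aa⁻¹≈1)))) x∈A))

    fromViolation : Violation V → StablePair n A B
    fromViolation (J , k , dimU , n<) =
      let X , dimX , _ , least = subset-span 𝟘 a (IsBasis.independent isBasis) J
          U = Meet J V
      in dyson {A = A} {B} k X U ℕ.≤-refl (least A (𝟘⊑ A) (λ i _ → IsBasis.members isBasis i)) (Meet⊑B J V) dimX dimU
        -- For fixed u in U, the x with ux ∈ A form a subspace that contains a i for every i in J,
        -- hence all of X.
        (λ x u x∈X (u∈B , u∈V) → Subspace.resp A (*-comm u x)
          (least (A ∶ u) (𝟘⊑ (A ∶ u)) (λ i i∈J → Subspace.resp A (*-comm (a i) u) (proj₂ (u∈V i i∈J))) x∈X))
        (subst (n <_) (ℕ.+-comm k FS.∣ J ∣) n<)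

  -- Bases of A that begin with a basis of S

  all-↑ : ∀ {p} m {n} {P : Fin (m ℕ.+ n) → Set p} → (∀ i → P (i ↑ˡ n)) → (∀ j → P (m ↑ʳ j)) → ∀ i → P i
  all-↑ m {n} {P} l r i = subst P (Fin.join-splitAt m n i) (at (splitAt m i))
    where
    at : ∀ x → P (join m n x)
    at (inj₁ i) = l i
    at (inj₂ j) = r j

  comb-split : ∀ m {n} (c v : Vector Carrier (m ℕ.+ n)) →
               comb c v ≈ comb (λ i → c (i ↑ˡ n)) (λ i → v (i ↑ˡ n)) + comb (λ i → c (m ↑ʳ i)) (λ i → v (m ↑ʳ i))
  comb-split m c v = sum-++ m (λ i → c i * v i)

  comb-congʳ : ∀ {n} (c : Vector Carrier n) {v w : Vector Carrier n} → (∀ i → v i ≈ w i) → comb c v ≈ comb c w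
  comb-congʳ c v≈w = sum-cong-≋ (λ i → *-congˡ (v≈w i))

  ++-isBasis : ∀ {s t} A S (u : Vector Carrier s) (v : Vector Carrier t) → S ⊑ A → Dim A (s ℕ.+ t) →
               IsBasisMod S 𝟘 u → IsBasisMod A S v → IsBasis F (members A) (u ++ v)
  ++-isBasis {s} {t} A S u v S⊑A dimA u-basis v-basis = independent⇒isBasis (u ++ v) dimA
    (all-↑ s (λ i → Subspace.resp A (sym (left i)) (S⊑A (U.∈V i))) (λ j → Subspace.resp A (sym (right j)) (V.∈V j)))
    λ c c∈F comb≈0 →
      let cˡ = λ i → c (i ↑ˡ t)
          cʳ = λ j → c (s ↑ʳ j)
          split≈0 : comb cˡ u + comb cʳ v ≈ 0#
          split≈0 = trans (sym (trans (comb-split s c (u ++ v))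
            (+-cong (comb-congʳ cˡ left) (comb-congʳ cʳ right)))) comb≈0
          -- Modulo S only the v-part of the relation survives.
          cʳ≈0 = V.independent cʳ (λ j → c∈F (s ↑ʳ j))
            (+-cancelˡ-∈ S (comb-closed S (λ i → c∈F (i ↑ˡ t)) U.∈V) (𝟘⊑ S split≈0))
          cˡ≈0 = U.independent cˡ (λ i → c∈F (i ↑ˡ t))
            (trans (sym (trans (+-congˡ (comb-0ˡ cʳ v cʳ≈0)) (+-identityʳ _))) split≈0)
      in all-↑ s cˡ≈0 cʳ≈0
    where
    module U = IsBasisMod u-basis
    module V = IsBasisMod v-basis

    left : ∀ i → (u ++ v) (i ↑ˡ t) ≈ u i
    left i = reflexive (lookup-++ˡ u v i)

    right : ∀ j → (u ++ v) (s ↑ʳ j) ≈ v j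
    right j = reflexive (lookup-++ʳ u v j)

  -- As a subspace that contains every b j with j ≠ i, it absorbs the lists with repetitions of
  -- `Span F (RangeExcept i b)` through `Span-least`.
  coordinateHyperplane : ∀ {n} → Vector Carrier n → Fin n → Subspace
  coordinateHyperplane b i = ⟪ (λ x → ∃ λ (c : Vector Carrier _) → (∀ j → c j ∈ F) × c i ≈ 0# × x ≈ comb c b) , record
    { resp     = λ x≈y (c , c∈F , cᵢ≈0 , x≈) → c , c∈F , cᵢ≈0 , trans (sym x≈y) x≈
    ; 0-closed = const 0# , (λ _ → F.0-closed) , ≈-refl , sym (comb-0ˡ (const 0#) b (λ _ → ≈-refl))
    ; +-closed = λ (c , c∈F , cᵢ≈0 , x≈) (d , d∈F , dᵢ≈0 , y≈) →
        (λ j → c j + d j) , (λ j → F.+-closed (c∈F j) (d∈F j)) ,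
        trans (+-cong cᵢ≈0 dᵢ≈0) (+-identityˡ 0#) , trans (+-cong x≈ y≈) (sym (comb-+ c d b))
    ; *-closed = λ {e} e∈F (c , c∈F , cᵢ≈0 , x≈) →
        (λ j → e * c j) , (λ j → F.*-closed e∈F (c∈F j)) ,
        trans (*-congˡ cᵢ≈0) (zeroʳ e) , trans (*-congˡ x≈) (sym (comb-* e c b))
    } ⟫

  unit-off-diag : ∀ {n} (i j : Fin n) → i ≢ j → unit i j ≈ 0#
  unit-off-diag zero    zero    0≢0 = contradiction refl 0≢0
  unit-off-diag zero    (suc j) _   = ≈-refl
  unit-off-diag (suc i) zero    _   = ≈-refl
  unit-off-diag (suc i) (suc j) i≢j = unit-off-diag i j (i≢j ∘ ≡-cong suc)

  coordinate≈0 : ∀ {n} (b c : Vector Carrier n) i → IndependentMod 𝟘 b → (∀ j → c j ∈ F) →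
                 comb c b ∈ Span F (RangeExcept i b) → c i ≈ 0#
  coordinate≈0 b c i ind c∈F comb∈ =
    let d , d∈F , dᵢ≈0 , comb≈ = Span-least (coordinateHyperplane b i) {X = RangeExcept i b}
          (λ (j , j≢i , x≈) → unit j , unit-closed j , unit-off-diag j i j≢i , trans x≈ (sym (comb-unit j b))) comb∈
    in trans (comb-injective c d b ind c∈F d∈F comb≈ i) dᵢ≈0

  -- A basis of A that starts with a basis of S can only be matched if R lies in the span of the last t
  -- vectors of the matching basis of B.
  stable⇒unmatchable : ∀ {s t r} A B S R → S ⊑ A → R ⊑ B → Dim A (s ℕ.+ t) → Dim S s → Codim A S t → Dim R r →
    (∀ x u → x ∈ˢ S → u ∈ˢ R → x * u ∈ˢ S) → t < r → Unmatchable (s ℕ.+ t) F (members A) (members B)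
  stable⇒unmatchable {s} {t} {r} A B S R S⊑A R⊑B dimA dimS codimS dimR SR⊆S t<r matchable =
    let u , u-basis = codim⇒basis dimS
        v , v-basis = codim⇒basis codimS
        b , b-isBasis , matched = matchable (u ++ v) (++-isBasis A S u v S⊑A dimA u-basis v-basis)
    in absurd u v u-basis v-basis b b-isBasis matched
    where
    absurd : (u : Vector Carrier s) (v : Vector Carrier t) → IsBasisMod S 𝟘 u → IsBasisMod A S v →
             ∀ b → IsBasis F (members B) b → BasisMatched F (members A) (members B) (u ++ v) b → ⊥
    absurd u v u-basis v-basis b b-isBasis matched =
      ℕ.<⇒≱ t<r (codim-mono (LSpan-codim {W = 𝟘} bʳ bʳ-independent) (⊑-⊞ʳ 𝟘 (LSpan bʳ) ∘ R⊑) id dimR)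
      where
      module U = IsBasisMod u-basis
      bˡ = λ (i : Fin s) → b (i ↑ˡ t)
      bʳ = λ (j : Fin t) → b (s ↑ʳ j)

      bʳ-independent : IndependentMod 𝟘 bʳ
      bʳ-independent c c∈F comb≈0 j = trans (sym (right j))
        (IsBasis.independent b-isBasis 0++c
          (all-↑ s (λ i → F.resp (sym (left i)) F.0-closed) (λ j → F.resp (sym (right j)) (c∈F j)))
          (trans (comb-split s 0++c b) (trans
            (+-cong (comb-0ˡ _ bˡ left) (trans (sum-cong-≋ (λ j → *-congʳ (right j))) comb≈0)) (+-identityˡ 0#)))
          (s ↑ʳ j))
        where
        0s : Vector Carrier s
        0s = const 0#
        0++c = 0s ++ c

        left : ∀ i → 0++c (i ↑ˡ t) ≈ 0#
        left i = reflexive (lookup-++ˡ 0s c i)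

        right : ∀ j → 0++c (s ↑ʳ j) ≈ c j
        right j = reflexive (lookup-++ʳ 0s c j)

      -- Since `u i * x` lies in S ⊆ A, every x of R lies in (u i)⁻¹A ∩ B; matching then makes the
      -- first s coordinates of x vanish.
      R⊑ : R ⊑ LSpan bʳ
      R⊑ {x} x∈R =
        let c , c∈F , x≈ = Span⊆LSpan b (IsBasis.spanning b-isBasis (R⊑B x∈R))
            cˡ≈0 = λ i → coordinate≈0 b c (i ↑ˡ t) (IsBasis.independent b-isBasis) c∈F (in-Span x∈R x≈ i)
        in (λ j → c (s ↑ʳ j)) , (λ j → c∈F (s ↑ʳ j)) ,
           trans x≈ (trans (comb-split s c b) (trans (+-congʳ (comb-0ˡ _ bˡ cˡ≈0)) (+-identityˡ _)))
        where
        in-Span : ∀ {x y} → x ∈ˢ R → x ≈ y → ∀ i → y ∈ Span F (RangeExcept (i ↑ˡ t) b)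
        in-Span {x} x∈R x≈y i =
          let uᵢ≉0 = independent-∉ {W = 𝟘} u U.independent i
              u⁻¹ , uu⁻¹≈1 = inverse uᵢ≉0
              ux∈A = S⊑A (SR⊆S (u i) x (U.∈V i) x∈R)
          in matched (i ↑ˡ t)
               ((u⁻¹ , trans (*-congʳ (reflexive (lookup-++ˡ u v i))) uu⁻¹≈1 , u i * x , ux∈A ,
                 trans (sym x≈y) (sym (x-factor x uu⁻¹≈1))) ,
                R⊑B (Subspace.resp R x≈y x∈R))

-- Towers of fields

module Tower {ℓ} (em : ExcludedMiddle ℓ) (L : HeytingField ℓ ℓ ℓ)
  {K H : Extension.Subset L} (K-isSubfield : Extension.IsSubfield L K) (H-isSubfield : Extension.IsSubfield L H)
  (K⊆H : K ⊆ H) where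

  open FieldProperties em L
  private
    module K = LinearAlgebra em L K K-isSubfield
    module H = LinearAlgebra em L H H-isSubfield
  open K using (_∈ˢ_; _∉ˢ_; _⊑_; ⟪_,_⟫)

  restrict : H.Subspace → K.Subspace
  restrict V = ⟪ V.members , record
    { resp = V.resp ; 0-closed = V.0-closed ; +-closed = V.+-closed ; *-closed = λ c∈K → V.*-closed (K⊆H c∈K) } ⟫
    where module V = H.Subspace V

  -- Each step from W to W + xH over H is, over K, an extension by xH ≅ H, of dimension d.
  codim-tower : ∀ {V W m d} → K.Dim (restrict H.𝔽) d → W H.⊑ V → H.Codim V W m →
                K.Codim (restrict V) (restrict W) (m ℕ.* d)
  codim-tower dimH W⊑V (H.done V⊑W) = K.done V⊑W
  codim-tower {V} {W} {suc m} {d} dimH W⊑V (H.step x x∈V x∉W c) =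
    K.codim-trans line (codim-tower dimH W⊹x⊑V c) (H.⊑-⊞ˡ W (x H.◃ H.𝔽)) W⊹x⊑V
    where
    W⊹x⊑V = H.⊹-least W V W⊑V x∈V

    injective : ∀ {c} → c ∈ H → x * c ∈ˢ restrict W → c ≈ 0#
    injective {c} c∈H xc∈W = decidable-stable em λ c≉0 →
      x∉W (H.*-cancelˡ-∈ W c∈H c≉0 (H.Subspace.resp W (*-comm x c) xc∈W))

    line : K.Codim (restrict (W H.⊹ x)) (restrict W) d
    line = K.codim-resp id id
      (K.⊞-least (restrict W) (x K.◃ K.𝟘) (restrict W) id (λ (z , z≈0 , y≈) →
        H.𝟘⊑ W (trans y≈ (trans (*-congˡ z≈0) (zeroʳ x)))))
      (K.⊑-⊞ˡ (restrict W) (x K.◃ K.𝟘))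
      (K.codim-⊞ {restrict W} x (K.𝟘⊑ (restrict H.𝔽)) injective dimH)

  -- A step from W to W + xH absorbs at least the K-line of x, so the K-codimension drops. The bound
  -- b on it carries the recursion, as the new K-chain is not a part of the old one.
  codim-extend : ∀ b {V W k} → k ≤ b → K.Codim (restrict V) (restrict W) k → ∃ (H.Codim V W)
  codim-extend b {V} {W} {k} k≤b codimV = by-cases b k≤b em
    where
    by-cases : ∀ b → k ≤ b → Dec (∃[ x ] x ∈ˢ restrict V × x ∉ˢ restrict W) → ∃ (H.Codim V W)
    by-cases _ _ (no none) =
      0 , H.done (λ {x} x∈V → decidable-stable em (λ x∉W → none (x , x∈V , x∉W)))
    by-cases b k≤b (yes (x , x∈V , x∉W)) = recurse b k k≤b codimV
      where
      W⊑W⊹x : restrict W K.⊹ x ⊑ restrict (W H.⊹ x)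
      W⊑W⊹x = K.⊹-least (restrict W) (restrict (W H.⊹ x)) (H.⊑-⊞ˡ W (x H.◃ H.𝔽)) (H.x∈W⊹x W x)

      recurse : ∀ b k → k ≤ b → K.Codim (restrict V) (restrict W) k → ∃ (H.Codim V W)
      recurse _ zero _ (K.done V⊑W) = contradiction (V⊑W x∈V) x∉W
      recurse (suc b) (suc k) (s≤s k≤b) c =
        let c′ = K.codim-exchange {W = restrict W} x∈V x∉W c
            l , c″ = K.codim-exists {V′ = restrict V} {W′ = restrict (W H.⊹ x)} k c′ id W⊑W⊹x
            m , codimW⊹x = codim-extend b {V} {W H.⊹ x} (ℕ.≤-trans (K.codim-mono c′ id W⊑W⊹x c″) k≤b) c″
        in suc m , H.step x x∈V x∉W codimW⊹x

  -- x H embeds into V for any nonzero x ∈ V.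
  extension-dim : ∀ {V n x} → K.Dim (restrict V) n → x ∈ˢ restrict V → ¬ (x ≈ 0#) →
                  ∃[ d ] K.Dim (restrict H.𝔽) d × 0 < d
  extension-dim {V} {n} {x} dimV x∈V x≉0 =
    let x⁻¹ , xx⁻¹≈1 = inverse x≉0
        d , dim-xH = K.codim-exists {V′ = x K.◃ restrict H.𝔽} {W′ = K.𝟘} n dimV (H.◃𝔽-least V x∈V) id
        -- Multiplying xH, which lies in V, by x⁻¹ gives back H.
        dimH = K.codim-resp
          (λ (z , (c , c∈H , z≈) , y≈) → H.Subspace.resp H.𝔽
            (sym (trans y≈ (trans (*-congˡ z≈) (x-factor c xx⁻¹≈1)))) c∈H)
          (λ {c} c∈H → x * c , (c , c∈H , ≈-refl) , sym (x-factor c xx⁻¹≈1))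
          id id (K.dim-◃ {x K.◃ restrict H.𝔽} (inverse≉0 xx⁻¹≈1) dim-xH)
    in d , dimH , positive dimH
    where
    positive : ∀ {d} → K.Dim (restrict H.𝔽) d → 0 < d
    positive (K.done H⊑𝟘)      = contradiction (H⊑𝟘 (H.F.1-closed)) 1≉0
    positive (K.step _ _ _ _) = s≤s z≤n

-- Obstructions to matching

module _ {ℓ} (em : ExcludedMiddle ℓ) (L : HeytingField ℓ ℓ ℓ) (K : Extension.Subset L)
  (K-isSubfield : Extension.IsSubfield L K) where

  open FieldProperties em L
  open Extension L hiding (sum; cong)
  open LinearAlgebra em L K K-isSubfield

  private
    ⟮⟯-sub : ∀ R → IsSubfield (K ⟮ R ⟯)
    ⟮⟯-sub R = ⟮⟯-isSubfield R K-isSubfield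

    module Over R = LinearAlgebra em L (K ⟮ R ⟯) (⟮⟯-sub R)
    module Ext R = Tower em L {K} {K ⟮ R ⟯} K-isSubfield (⟮⟯-sub R) base

  stable⇒⟮⟯-subspace : ∀ {n} S R → Dim S n → (∀ x u → x ∈ˢ S → u ∈ˢ R → x * u ∈ˢ S) →
                       IsSubspace (K ⟮ Subspace.members R ⟯) (Subspace.members S)
  stable⇒⟮⟯-subspace S R dimS SR⊆S = record
    { resp     = S.resp
    ; 0-closed = S.0-closed
    ; +-closed = S.+-closed
    ; *-closed = λ {_} {x} c∈ x∈S → ⟮⟯-least (stabilizer-isSubfield S dimS) (Stabilizer-F S)
        (λ {u} u∈R x x∈S → S.resp (*-comm x u) (SR⊆S x u x∈S u∈R)) c∈ x x∈S
    }
    where module S = Subspace S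

  stablePair⇒obstruction : ∀ {n} A B → Dim A n → Dim B n → StablePair n A B →
    ∃[ R ] ∃[ S ] ∃[ Y ] ∃[ Z ] ∃[ m ] ∃[ a ] IsObstruction K (Subspace.members A) (Subspace.members B) R S Y Z m a
  stablePair⇒obstruction {n} A B dimA dimB (S , R , p , q , S⊑A , R⊑B , dimS , dimR , SR⊆S , n<p+q) =
    let Y , t , dimY , p+t≡n , A=S⊕Y = complement A S S⊑A dimA dimS
        Z , _ , _ , _ , B=R⊕Z = complement B R R⊑B dimB dimR
        -- The K-dimension p of S bounds chains over K(R), so nothing about [K(R) : K] has to be
        -- known here.
        m , codimS = Ext.codim-extend (Subspace.members R) p {Sᴴ} {𝟘ᴴ} ℕ.≤-refl
          (codim-resp {S} {Ext.restrict (Subspace.members R) Sᴴ} {𝟘} {Ext.restrict (Subspace.members R) 𝟘ᴴ} id id id id dimS)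
        a , a-isBasis = Over.dim⇒hasDim (Subspace.members R) Sᴴ codimS
    in Subspace.members R , Subspace.members S , Subspace.members Y , Subspace.members Z , m , a , record
      { R-subspace = Subspace.isSubspace R
      ; S-subspace = Subspace.isSubspace S
      ; Y-subspace = Subspace.isSubspace Y
      ; Z-subspace = Subspace.isSubspace Z
      ; R⊆B        = R⊑B
      ; R-nonzero  = R-nonzero
      ; A=S⊕Y      = A=S⊕Y
      ; B=R⊕Z      = B=R⊕Z
      ; dimY<dimR  = t , q , dim⇒hasDim Y dimY , dim⇒hasDim R dimR ,
                     ℕ.+-cancelˡ-< p t q (subst (_< p ℕ.+ q) (≡-sym p+t≡n) n<p+q)
      ; a∈S        = IsBasis.members a-isBasis
      ; S=⊕aK⟮R⟯   = Over.basis⇒directSum (Subspace.members R) Sᴴ a a-isBasis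
      ; dimS=m     = a , a-isBasis
      }
    where
    Sᴴ 𝟘ᴴ : Over.Subspace (Subspace.members R)
    𝟘ᴴ = Over.𝟘 (Subspace.members R)
    Sᴴ = Over.⟪ Subspace.members S , stable⇒⟮⟯-subspace S R dimS SR⊆S ⟫

    -- R = 0 would give q = 0 and so dim S = p > n = dim A.
    R-nonzero : ∃[ r ] r ∈ˢ R × ¬ (r ≈ 0#)
    R-nonzero = nonzero dimR n<p+q
      where
      nonzero : ∀ {q} → Dim R q → n < p ℕ.+ q → ∃[ r ] r ∈ˢ R × ¬ (r ≈ 0#)
      nonzero (step r r∈R r≉0 _) _ = r , r∈R , r≉0
      nonzero (done _) n<p+0 = contradiction (codim-mono dimA S⊑A id dimS)
        (ℕ.<⇒≱ (subst (n <_) (ℕ.+-identityʳ p) n<p+0))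

  module _ {n} (A B : Subspace) (dimA : Dim A n) (dimB : Dim B n)
    {R S Y Z : Subset} {m} {a : Vector Carrier m}
    (obstruction : IsObstruction K (Subspace.members A) (Subspace.members B) R S Y Z m a) where

    open IsObstruction obstruction

    private
      Rˢ Sˢ Yˢ : Subspace
      Rˢ = ⟪ R , R-subspace ⟫
      Sˢ = ⟪ S , S-subspace ⟫
      Yˢ = ⟪ Y , Y-subspace ⟫

      Sᴴ : Over.Subspace R
      Sᴴ = Over.⟪ S , record
        { resp = Subspace.resp Sˢ ; 0-closed = Subspace.0-closed Sˢ ; +-closed = Subspace.+-closed Sˢ
        ; *-closed = Over.directSum-*-closed R a S=⊕aK⟮R⟯ } ⟫

      y = proj₁ dimY<dimR
      r = proj₁ (proj₂ dimY<dimR)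
      dimY = hasDim⇒dim Yˢ (proj₁ (proj₂ (proj₂ dimY<dimR)))
      dimR = hasDim⇒dim Rˢ (proj₁ (proj₂ (proj₂ (proj₂ dimY<dimR))))
      y<r = proj₂ (proj₂ (proj₂ (proj₂ dimY<dimR)))

      S⊑A : Sˢ ⊑ A
      S⊑A x∈S = proj₁ (proj₂ (directSum⁻ A Sˢ Yˢ A=S⊕Y)) (⊑-⊞ˡ Sˢ Yˢ x∈S)

      codimS : Codim A Sˢ y
      codimS = directSum-codim A Sˢ Yˢ A=S⊕Y dimY

      s = proj₁ (codim-exists {V′ = Sˢ} {𝟘} {𝟘} n dimA S⊑A id)

      dimS : Dim Sˢ s
      dimS = proj₂ (codim-exists {V′ = Sˢ} {𝟘} {𝟘} n dimA S⊑A id)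

      s+y≡n : s ℕ.+ y ≡ n
      s+y≡n = codim-unique (codim-trans dimS codimS (𝟘⊑ Sˢ) S⊑A) dimA

    obstruction⇒unmatchable : Unmatchable n K (Subspace.members A) (Subspace.members B)
    -- A basis adapted to S has length s + y by construction, which equals n only through `s+y≡n`.
    obstruction⇒unmatchable = subst (λ n → Unmatchable n K (Subspace.members A) (Subspace.members B)) s+y≡n
      (stable⇒unmatchable A B Sˢ Rˢ S⊑A R⊆B (subst (Dim A) (≡-sym s+y≡n) dimA) dimS codimS dimR
        (λ x u x∈S u∈R → Subspace.resp Sˢ (*-comm u x) (Over.directSum-*-closed R a S=⊕aK⟮R⟯ (gen u∈R) x∈S))
        y<r)

    obstruction⇒dim : ∃[ s ] ∃[ d ] HasDim K S s × HasDim K (K ⟮ R ⟯) d × 0 < d × s ≡ m ℕ.* d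
    obstruction⇒dim =
      let x , x∈S , x≉0 = S-nonzero dimS s+y≡n
          d , dimH , 0<d = Ext.extension-dim R {Sᴴ} {x = x} dimS′ x∈S x≉0
      in m ℕ.* d , d ,
         dim⇒hasDim Sˢ (codim-resp {Ext.restrict R Sᴴ} {Sˢ} {Ext.restrict R (Over.𝟘 R)} {𝟘} id id id id
           (Ext.codim-tower R dimH (Over.𝟘⊑ R Sᴴ) (Over.hasDim⇒dim R Sᴴ dimS=m))) ,
         dim⇒hasDim (Ext.restrict R (Over.𝔽 R)) dimH , 0<d , refl
      where
      dimS′ : Dim (Ext.restrict R Sᴴ) s
      dimS′ = codim-resp {Sˢ} {Ext.restrict R Sᴴ} {𝟘} {𝟘} id id id id dimS

      -- If S = 0, then dim R > dim Y = n, which is impossible inside B. The nonzero vector of S is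
      -- what makes [K(R) : K] finite.
      S-nonzero : ∀ {s} → Dim Sˢ s → s ℕ.+ y ≡ n → ∃[ x ] x ∈ S × ¬ (x ≈ 0#)
      S-nonzero (step x x∈S x≉0 _) _ = x , x∈S , x≉0
      S-nonzero (done _) y≡n = contradiction (codim-mono dimB R⊆B id dimR) (ℕ.<⇒≱ (subst (_< r) y≡n y<r))

open import Data.Nat.Base using (_*_)

theorem3p3 : ∀ {ℓ} → ExcludedMiddle ℓ → (L : HeytingField ℓ ℓ ℓ) → let open Extension L in
    ∀ (K : Subset) → IsSubfield K → K ⊊L →
    ∀ (n : ℕ) → 0 < n →
    ∀ (A B : Subset) → IsSubspace K A → IsSubspace K B → HasDim K A n → HasDim K B n →
    (Unmatchable n K A B ⇔
    (∃[ R ] ∃[ S ] ∃[ Y ] ∃[ Z ] ∃[ m ] ∃[ a ] IsObstruction K A B R S Y Z m a)) ×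
    (∀ R S Y Z m a → IsObstruction K A B R S Y Z m a →
    ∃[ s ] ∃[ d ] HasDim K S s × HasDim K (K ⟮ R ⟯) d × 0 < d × s ≡ m * d)
theorem3p3 {ℓ} em L K K-isSubfield _ n _ A B A-subspace B-subspace hasDimA hasDimB =
  mk⇔ forward (λ (_ , _ , _ , _ , _ , _ , obs) → obstruction⇒unmatchable em L K K-isSubfield Aˢ Bˢ dimA dimB obs) ,
  λ _ _ _ _ _ _ → obstruction⇒dim em L K K-isSubfield Aˢ Bˢ dimA dimB
  where
  open Extension L hiding (cong)
  open LinearAlgebra em L K K-isSubfield
  Aˢ = ⟪ A , A-subspace ⟫
  Bˢ = ⟪ B , B-subspace ⟫
  dimA = hasDim⇒dim Aˢ hasDimA
  dimB = hasDim⇒dim Bˢ hasDimB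

  Unmatched : Vector (HeytingField.Carrier L) n → Set ℓ
  Unmatched a = ¬ (∃ λ (b : Vector (HeytingField.Carrier L) n) → IsBasis K B b × BasisMatched K A B a b)

  forward : Unmatchable n K A B → ∃[ R ] ∃[ S ] ∃[ Y ] ∃[ Z ] ∃[ m ] ∃[ a ] IsObstruction K A B R S Y Z m a
  forward unmatchable =
    let a , a-isBasis , unmatched = unmatched-basis
    in stablePair⇒obstruction em L K K-isSubfield Aˢ Bˢ dimA dimB
         (unmatched⇒stablePair Aˢ Bˢ dimB a a-isBasis unmatched)
    where
    unmatched-basis : ∃[ a ] IsBasis K A a × Unmatched a
    -- `Unmatchable` is a bare negation; a basis of A without a partner is extracted from it
    -- classically.
    unmatched-basis = decidable-stable em λ none →
      unmatchable λ a a-isBasis → decidable-stable em λ unmatched → none (a , a-isBasis , unmatched)
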